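{- The labeled natural deduction system $\mathcal{N}(Kl)$ is sound and complete: for every set $\Gamma$ of labeled formulas, every set $\Delta$ of relational formulas, and every formula $\varphi$ (labeled or relational), $$\Gamma,\Delta\vdash\varphi\quad\text{iff}\quad \Gamma,\Delta\models^{\mathcal{M},\lambda}\varphi\ \text{ for every $Kl$ model }\mathcal{M}\text{ and every interpretation }\lambda .$$
   Context: Syntax. Fix an infinite set $L$ of labels and a set $\mathcal{P}$ of propositional variables. $Kl$ formulas: $A::=p\mid\bot\mid A\supset A\mid\mathsf{G}A\mid\mathsf{H}A$ with $p\in\mathcal{P}$. A labeled formula (lwff) is $x:A$ with $x\in L$ and $A$ a $Kl$ formula. Relational formulas (rwffs): $\rho::=x<y\mid x=y\mid\emptyset\mid\rho\sqsupset\rho\mid\forall x.\,\rho$ with $x,y\in L$ (labels act as individual variables; $\emptyset$ is the relational falsum, $\sqsupset$ is relational implication). A formula $\varphi$ is an lwff or an rwff. $\varphi[y/x]$ is (capture-avoiding) substitution of label $y$ for label $x$; in particular $(x:A)[y/x]$ is $y:A$. Abbreviations: $\neg\rho\equiv\rho\sqsupset\emptyset$, $\rho'\sqcup\rho''\equiv(\rho'\sqsupset\emptyset)\sqsupset\rho''$, $\rho'\sqcap\rho''\equiv\neg(\rho'\sqsupset\neg\rho'')$. A proof context is a pair $(\Gamma,\Delta)$ with $\Gamma$ a set of lwffs and $\Delta$ a set of rwffs. Semantics. A $Kl$ model is $\mathcal{M}=(\mathcal{W},\prec,\mathcal{V})$ with $\mathcal{W}\neq\varnothing$, $\prec\subseteq\mathcal{W}\times\mathcal{W}$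 irreflexive, transitive and connected (for all $x,y\in\mathcal{W}$: $x=y$ or $x\prec y$ or $y\prec x$), and $\mathcal{V}:\mathcal{W}\times\mathcal{P}\to\{0,1\}$. An interpretation is a function $\lambda:L\to\mathcal{W}$; $\lambda[y\mapsto w]$ is $\lambda$ modified to send $y$ to $w$. Truth: $\models^{\mathcal{M},\lambda}x<y$ iff $\lambda(x)\prec\lambda(y)$; $\models^{\mathcal{M},\lambda}x=y$ iff $\lambda(x)=\lambda(y)$; $\not\models^{\mathcal{M},\lambda}\emptyset$; $\models^{\mathcal{M},\lambda}\rho_1\sqsupset\rho_2$ iff $\models^{\mathcal{M},\lambda}\rho_1$ implies $\models^{\mathcal{M},\lambda}\rho_2$; $\models^{\mathcal{M},\lambda}\forall x.\,\rho$ iff $\models^{\mathcal{M},\lambda[x\mapsto w]}\rho$ for all $w\in\mathcal{W}$; $\models^{\mathcal{M},\lambda}x:p$ iff $\mathcal{V}(\lambda(x),p)=1$; $\not\models^{\mathcal{M},\lambda}x:\bot$; $\models^{\mathcal{M},\lambda}x:A\supset B$ iff $\models^{\mathcal{M},\lambda}x:A$ implies $\models^{\mathcal{M},\lambda}x:B$; $\models^{\mathcal{M},\lambda}x:\mathsf{G}A$ (resp. $x:\mathsf{H}A$) iff for every $w\in\mathcal{W}$ with $\lambda(x)\prec w$ (resp. $w\prec\lambda(x)$), $\models^{\mathcal{M},\lambda[y\mapsto w]}y:A$, where $y\neq x$ is any label. $\Gamma,\Delta\models^{\mathcal{M},\lambda}\varphi$ means: if all formulas of $\Gamma\cup\Delta$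 are true in $\mathcal{M}$ under $\lambda$, then so is $\varphi$. The system $\mathcal{N}(Kl)$. Natural deduction rules (premises / conclusion, discharged assumptions in brackets): $RAA_\bot$: from $y:\bot$ infer $x:A$, discharging $[x:A\supset\bot]$ ($x,y$ arbitrary). $\supset\!I$: from $x:B$ infer $x:A\supset B$, discharging $[x:A]$. $\supset\!E$: from $x:A\supset B$ and $x:A$ infer $x:B$. $\mathsf{G}I$: from $y:A$ infer $x:\mathsf{G}A$, discharging $[x<y]$. $\mathsf{G}E$: from $x:\mathsf{G}A$ and $x<y$ infer $y:A$. $\mathsf{H}I$: from $y:A$ infer $x:\mathsf{H}A$, discharging $[y<x]$. $\mathsf{H}E$: from $x:\mathsf{H}A$ and $y<x$ infer $y:A$. In $\mathsf{G}I$ (resp. $\mathsf{H}I$), $y\ne x$ and $y$ does not occur in any assumption on which $y:A$ depends other than the discharged $x<y$ (resp. $y<x$). $RAA_\emptyset$: from $\emptyset$ infer $\rho$, discharging $[\rho\sqsupset\emptyset]$. $\sqsupset\!I$: from $\rho_2$ infer $\rho_1\sqsupset\rho_2$, discharging $[\rho_1]$. $\sqsupset\!E$: from $\rho_1\sqsupset\rho_2$ and $\rho_1$ infer $\rho_2$. $\forall I$: from $\rho$ infer $\forall x.\,\rho$, where $x$ does not occur free in any open assumption on which $\rho$ depends. $\forall E$: from $\forall x.\,\rho$ infer $\rho[y/x]$. Axioms (no premises): $\forall x.\,x=x$; $\forall x.\,\neg(x<x)$; $\forall x\,y\,z.\,(x<y\sqcap y<z)\sqsupset x<z$; $\forall x\,y.\,x<y\sqcup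 x=y\sqcup y<x$. General rules: $mon$: from $\varphi$ and $x=y$ infer $\varphi[y/x]$ ($\varphi$ an lwff or rwff). $uf1$: from $x:\bot$ infer $\emptyset$. $uf2$: from $\emptyset$ infer $x:\bot$. $\Gamma,\Delta\vdash\varphi$ means there is a derivation tree built with these rules ending with $\varphi$ whose open assumptions form a finite subset of $\Gamma\cup\Delta$. -}

module Defs where

open import Level using (Level; 0ℓ) renaming (suc to lsuc)
open import Data.Bool.Base using (Bool; true; if_then_else_)
open import Data.Empty using (⊥)
open import Data.List.Base using (List; []; _∷_; _++_; map; filter)
open import Data.List.Membership.Propositional using (_∈_; _∉_)
import Data.List.Membership.DecPropositional as DecMembership
open import Data.Product.Base using (Σ-syntax; ∃; _×_; proj₁)
open import Data.Sum.Base using (_⊎_)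
open import Function.Base using (id)
open import Relation.Binary.Bundles using (Poset)
open import Relation.Binary.Core using (Rel)
open import Relation.Binary.Definitions using (DecidableEquality; Irreflexive; Transitive)
open import Relation.Binary.PropositionalEquality using (_≡_; _≢_)
open import Relation.Nullary.Decidable.Core using (does; ¬?)
open import Relation.Unary using (Pred)

-- No finite list exhausts A.
Infinite : ∀ {a} → Set a → Set a
Infinite A = (xs : List A) → ∃ λ x → x ∉ xs

ZornsLemma : (ℓ : Level) → Set (lsuc ℓ)
ZornsLemma ℓ =
  (O : Poset ℓ ℓ ℓ) → let open Poset O in
  ((C : Pred Carrier ℓ) →
     (∀ {x y} → C x → C y → x ≤ y ⊎ y ≤ x) →
     ∃ λ u → ∀ {x} → C x → x ≤ u) →
  ∃ λ m → ∀ {x} → m ≤ x → m ≈ x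

module LinearTense
  (L Var : Set) (_≟_ : DecidableEquality L) (infinite : Infinite L) where

  infix  8 _<_ _≐_
  infixr 7 _⊓_
  infixr 6 _⊔_
  infixr 5 _⊐_
  infixr 7 _⊃_
  infix  4 _∶_

  ----------------------------------------------------------------------
  -- Syntax

  data Kl : Set where
    var : Var → Kl
    ⊥′  : Kl
    _⊃_ : Kl → Kl → Kl
    G H : Kl → Kl

  data LWff : Set where
    _∶_ : L → Kl → LWff

  data RWff : Set where
    _<_ _≐_ : L → L → RWff
    ∅       : RWff
    _⊐_     : RWff → RWff → RWff
    all     : L → RWff → RWff

  data Formula : Set where
    lwff : LWff → Formula
    rwff : RWff → Formula

  ~_ : RWff → RWff
  ~ ρ = ρ ⊐ ∅

  _⊔_ _⊓_ : RWff → RWff → RWff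
  ρ ⊔ ρ′ = (ρ ⊐ ∅) ⊐ ρ′
  ρ ⊓ ρ′ = ~ (ρ ⊐ ~ ρ′)

  freeR : RWff → List L
  freeR (x < y)   = x ∷ y ∷ []
  freeR (x ≐ y)   = x ∷ y ∷ []
  freeR ∅         = []
  freeR (ρ ⊐ ρ′)  = freeR ρ ++ freeR ρ′
  freeR (all x ρ) = filter (λ y → ¬? (y ≟ x)) (freeR ρ)

  free : Formula → List L
  free (lwff (x ∶ _)) = x ∷ []
  free (rwff ρ)       = freeR ρ

  -- All labels that occur, whether free, bound or binding.
  labelsR : RWff → List L
  labelsR (x < y)   = x ∷ y ∷ []
  labelsR (x ≐ y)   = x ∷ y ∷ []
  labelsR ∅         = []
  labelsR (ρ ⊐ ρ′)  = labelsR ρ ++ labelsR ρ′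
  labelsR (all x ρ) = x ∷ labelsR ρ

  labels : Formula → List L
  labels (lwff (x ∶ _)) = x ∷ []
  labels (rwff ρ)       = labelsR ρ

  _[_↦_] : ∀ {a} {A : Set a} → (L → A) → L → A → (L → A)
  (f [ x ↦ a ]) y = if does (y ≟ x) then a else f y

  open DecMembership _≟_ using (_∈?_)

  -- x itself, unless it is in the list to be avoided.
  avoid : L → List L → L
  avoid x xs = if does (x ∈? xs) then proj₁ (infinite xs) else x

  -- Simultaneous substitution, so that renaming a bound label needs no
  -- second traversal; a bound label is renamed only if it would capture.
  subR : (L → L) → RWff → RWff
  subR σ (x < y)   = σ x < σ y
  subR σ (x ≐ y)   = σ x ≐ σ y
  subR σ ∅         = ∅
  subR σ (ρ ⊐ ρ′)  = subR σ ρ ⊐ subR σ ρ′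
  subR σ (all x ρ) = all z (subR (σ [ x ↦ z ]) ρ)
    where z = avoid x (map σ (freeR (all x ρ)))

  sub : (L → L) → Formula → Formula
  sub σ (lwff (x ∶ A)) = lwff (σ x ∶ A)
  sub σ (rwff ρ)       = rwff (subR σ ρ)

  -- φ [ y / x ]: y replaces x.
  _[_/_] : Formula → L → L → Formula
  φ [ y / x ] = sub (id [ x ↦ y ]) φ

  ----------------------------------------------------------------------
  -- Semantics

  record Model : Set₁ where
    infix 4 _≺_
    field
      W         : Set
      nonempty  : W
      _≺_       : Rel W 0ℓ
      irrefl    : Irreflexive _≡_ _≺_
      trans     : Transitive _≺_
      connected : ∀ u v → u ≡ v ⊎ u ≺ v ⊎ v ≺ u
      V         : W → Var → Bool

  module _ (M : Model) where
    open Model M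

    Interpretation : Set
    Interpretation = L → W

    TrueL : Interpretation → L → Kl → Set
    TrueL λ′ x (var p) = V (λ′ x) p ≡ true
    TrueL λ′ x ⊥′      = ⊥
    TrueL λ′ x (A ⊃ B) = TrueL λ′ x A → TrueL λ′ x B
    TrueL λ′ x (G A)   = ∀ w → λ′ x ≺ w → ∀ y → y ≢ x → TrueL (λ′ [ y ↦ w ]) y A
    TrueL λ′ x (H A)   = ∀ w → w ≺ λ′ x → ∀ y → y ≢ x → TrueL (λ′ [ y ↦ w ]) y A

    TrueR : Interpretation → RWff → Set
    TrueR λ′ (x < y)   = λ′ x ≺ λ′ y
    TrueR λ′ (x ≐ y)   = λ′ x ≡ λ′ y
    TrueR λ′ ∅         = ⊥
    TrueR λ′ (ρ ⊐ ρ′)  = TrueR λ′ ρ → TrueR λ′ ρ′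
    TrueR λ′ (all x ρ) = ∀ w → TrueR (λ′ [ x ↦ w ]) ρ

    True : Interpretation → Formula → Set
    True λ′ (lwff (x ∶ A)) = TrueL λ′ x A
    True λ′ (rwff ρ)       = TrueR λ′ ρ

  _∈⟨_⨾_⟩ : Formula → Pred LWff 0ℓ → Pred RWff 0ℓ → Set
  lwff α ∈⟨ Γ ⨾ Δ ⟩ = Γ α
  rwff ρ ∈⟨ Γ ⨾ Δ ⟩ = Δ ρ

  _⨾_⊨[_,_]_ : Pred LWff 0ℓ → Pred RWff 0ℓ →
               (M : Model) → Interpretation M → Formula → Set
  Γ ⨾ Δ ⊨[ M , λ′ ] φ = (∀ ψ → ψ ∈⟨ Γ ⨾ Δ ⟩ → True M λ′ ψ) → True M λ′ φ

  ----------------------------------------------------------------------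
  -- Derivation trees, and the assumptions they leave open

  data Deriv : Formula → Set
  Open : ∀ {φ} → Deriv φ → Pred Formula 0ℓ

  data Deriv where
    assume : ∀ φ → Deriv φ

    -- The formulas discharged by a rule are named in the clause of Open
    -- for that rule.
    RAA⊥ : ∀ {x y A} → Deriv (lwff (y ∶ ⊥′)) → Deriv (lwff (x ∶ A))
    ⊃I : ∀ {x A B} → Deriv (lwff (x ∶ B)) → Deriv (lwff (x ∶ A ⊃ B))
    ⊃E : ∀ {x A B} → Deriv (lwff (x ∶ A ⊃ B)) → Deriv (lwff (x ∶ A)) → Deriv (lwff (x ∶ B))
    GI : ∀ {x y A} (d : Deriv (lwff (y ∶ A))) → y ≢ x →
         (∀ ψ → Open d ψ → ψ ≢ rwff (x < y) → y ∉ labels ψ) →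
         Deriv (lwff (x ∶ G A))
    GE : ∀ {x y A} → Deriv (lwff (x ∶ G A)) → Deriv (rwff (x < y)) → Deriv (lwff (y ∶ A))
    HI : ∀ {x y A} (d : Deriv (lwff (y ∶ A))) → y ≢ x →
         (∀ ψ → Open d ψ → ψ ≢ rwff (y < x) → y ∉ labels ψ) →
         Deriv (lwff (x ∶ H A))
    HE : ∀ {x y A} → Deriv (lwff (x ∶ H A)) → Deriv (rwff (y < x)) → Deriv (lwff (y ∶ A))

    RAA∅ : ∀ {ρ} → Deriv (rwff ∅) → Deriv (rwff ρ)
    ⊐I : ∀ {ρ₁ ρ₂} → Deriv (rwff ρ₂) → Deriv (rwff (ρ₁ ⊐ ρ₂))
    ⊐E : ∀ {ρ₁ ρ₂} → Deriv (rwff (ρ₁ ⊐ ρ₂)) → Deriv (rwff ρ₁) → Deriv (rwff ρ₂)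
    ∀I : ∀ {x ρ} (d : Deriv (rwff ρ)) →
         (∀ ψ → Open d ψ → x ∉ free ψ) →
         Deriv (rwff (all x ρ))
    ∀E : ∀ {x ρ} y → Deriv (rwff (all x ρ)) → Deriv (rwff ρ [ y / x ])

    ax-refl      : ∀ x → Deriv (rwff (all x (x ≐ x)))
    ax-irrefl    : ∀ x → Deriv (rwff (all x (~ (x < x))))
    ax-trans     : ∀ x y z → x ≢ y → y ≢ z → x ≢ z →
                   Deriv (rwff (all x (all y (all z (x < y ⊓ y < z ⊐ x < z)))))
    ax-connected : ∀ x y → x ≢ y →
                   Deriv (rwff (all x (all y (x < y ⊔ x ≐ y ⊔ y < x))))

    mon : ∀ {φ x y} → Deriv φ → Deriv (rwff (x ≐ y)) → Deriv (φ [ y / x ])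
    uf1 : ∀ {x} → Deriv (lwff (x ∶ ⊥′)) → Deriv (rwff ∅)
    uf2 : ∀ {x} → Deriv (rwff ∅) → Deriv (lwff (x ∶ ⊥′))

  Open (assume φ) ψ                = ψ ≡ φ
  Open (RAA⊥ {x} {y} {A} d) ψ      = Open d ψ × ψ ≢ lwff (x ∶ A ⊃ ⊥′)
  Open (⊃I {x} {A} {B} d) ψ        = Open d ψ × ψ ≢ lwff (x ∶ A)
  Open (⊃E d e) ψ                  = Open d ψ ⊎ Open e ψ
  Open (GI {x} {y} {A} d _ _) ψ    = Open d ψ × ψ ≢ rwff (x < y)
  Open (GE d e) ψ                  = Open d ψ ⊎ Open e ψ
  Open (HI {x} {y} {A} d _ _) ψ    = Open d ψ × ψ ≢ rwff (y < x)
  Open (HE d e) ψ                  = Open d ψ ⊎ Open e ψ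
  Open (RAA∅ {ρ} d) ψ              = Open d ψ × ψ ≢ rwff (ρ ⊐ ∅)
  Open (⊐I {ρ₁} {ρ₂} d) ψ          = Open d ψ × ψ ≢ rwff ρ₁
  Open (⊐E d e) ψ                  = Open d ψ ⊎ Open e ψ
  Open (∀I d _) ψ                  = Open d ψ
  Open (∀E y d) ψ                  = Open d ψ
  Open (ax-refl x) ψ               = ⊥
  Open (ax-irrefl x) ψ             = ⊥
  Open (ax-trans x y z _ _ _) ψ    = ⊥
  Open (ax-connected x y _) ψ      = ⊥
  Open (mon d e) ψ                 = Open d ψ ⊎ Open e ψ
  Open (uf1 d) ψ                   = Open d ψ
  Open (uf2 d) ψ                   = Open d ψ

  -- Trees are finite, so only finitely many assumptions are open.
  _⨾_⊢_ : Pred LWff 0ℓ → Pred RWff 0ℓ → Formula → Set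
  Γ ⨾ Δ ⊢ φ = Σ[ d ∈ Deriv φ ] (∀ ψ → Open d ψ → ψ ∈⟨ Γ ⨾ Δ ⟩)

{-# OPTIONS --safe #-}

-- Completeness is proved by a Henkin construction. Instead of a language with
-- more labels we use formulas paired with an assignment of constants to their
-- labels. A finite set of them is refutable if every assignment of labels to
-- constants turns it into a set from which ∅ is derivable. Each formula x : GA,
-- x : HA or ∀x.ρ comes with a constant witnessing its failure. A maximal
-- consistent set, which exists by the Teichmüller–Tukey lemma, gives a model
-- whose worlds are representatives of the constants modulo provable equality.
module Submission where

open import Defs
open import Level using (0ℓ)
open import Axiom.ExcludedMiddle using (ExcludedMiddle)
open import Axiom.UniquenessOfIdentityProofs.WithK using (uip)
open import Data.Bool.Base using (Bool; true; false; if_then_else_)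
open import Data.Empty using (⊥; ⊥-elim)
open import Data.List.Base using (List; []; _∷_; _++_; map; concat; filter; length)
open import Data.List.Extrema.Nat using (argmin; f[argmin]≤f[⊤]; f[argmin]≤f[xs]; argmin-sel)
import Data.List.Membership.DecPropositional as DecMembership
open import Data.List.Membership.Propositional using (_∈_; _∉_; lose)
open import Data.List.Membership.Propositional.Properties
  using (∈-++⁺ˡ; ∈-++⁺ʳ; ∈-++⁻; ∈-map⁺; ∈-map⁻; ∈-filter⁺; ∈-filter⁻; ∈-concat⁺′)
open import Data.List.Properties using (map-cong-local; filter-notAll)
open import Data.List.Relation.Binary.Subset.Propositional using (_⊆_)
open import Data.List.Relation.Binary.Subset.Propositional.Properties
  using (⊆-refl; ∷⁺ʳ; ∈-∷⁺ʳ; map⁺)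
open import Data.List.Relation.Unary.All as All using (All; []; _∷_)
open import Data.List.Relation.Unary.All.Properties using (++⁺)
open import Data.List.Relation.Unary.Any using (Any; here; there)
open import Data.Nat.Base as ℕ using (ℕ; suc; s≤s)
import Data.Nat.Properties as ℕ
open import Data.Nat.ListAction using (sum)
open import Data.Product.Base using (Σ; ∃; _×_; _,_; proj₁; proj₂)
open import Data.Sum.Base as Sum using (_⊎_; inj₁; inj₂; [_,_]′)
open import Function.Base using (id; _∘_)
open import Function.Bundles using (_⇔_; mk⇔; Equivalence)
open import Relation.Binary.Bundles using (Poset)
open import Relation.Binary.PropositionalEquality
  using (_≡_; _≢_; refl; sym; trans; cong; cong₂; subst; subst₂)
open import Relation.Nullary using (¬_; yes; no; does; contradiction; ¬?)
open import Relation.Nullary.Decidable using (dec-true; dec-false; decidable-stable)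
open import Relation.Unary using (Pred)

-- `Γ` and `Δ` may together mention every label, so `L` itself need not contain a label that is
-- fresh for all of them; a single derivation, however, has a finite context, and there a fresh
-- label always exists. New constants are therefore kept outside the calculus and become labels only
-- when a finite set is translated. The second obstacle is that no connective joins a labeled
-- formula to a relational one. The statement "if `x : GA` fails, then it fails at some later
-- witness" is not a formula, and neither is its negation. It is replaced by a condition on finite
-- contexts, and consistency means that no finite part is refuted with the help of finitely many
-- such conditions. Since the two kinds of formula meet only in falsum, all properties of the
-- maximal set are phrased through derivations of ∅.

-- Teichmüller–Tukey lemma. Sets are Bool-valued because the poset given to
-- Zorn's lemma has to live in Set.
module Tukey (em : ExcludedMiddle 0ℓ) (zorn : ZornsLemma 0ℓ) (X : Set)
  (Bad : List X → Set) (mono : ∀ {F F′} → F ⊆ F′ → Bad F → Bad F′) where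

  ∈ᵇ_ : (X → Bool) → Pred X 0ℓ
  (∈ᵇ m) x = m x ≡ true

  comprehend : Pred X 0ℓ → X → Bool
  comprehend P x = does (em {P x})

  comprehend⁺ : ∀ (P : Pred X 0ℓ) {x} → P x → (∈ᵇ comprehend P) x
  comprehend⁺ P = dec-true em

  comprehend⁻ : ∀ (P : Pred X 0ℓ) {x} → (∈ᵇ comprehend P) x → P x
  comprehend⁻ P {x} x∈ with em {P x} | x∈
  ... | yes p | _ = p

  Good : Pred X 0ℓ → Set
  Good P = ∀ F → All P F → ¬ Bad F

  -- Maximality is recorded as a finite obstruction to adding `x` rather than in terms of the
  -- inclusion order: such obstructions are what later arguments combine.
  record Maximal (S : Pred X 0ℓ) : Set where
    field
      mem      : X → Bool
      includes : ∀ {x} → S x → (∈ᵇ mem) x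
      good     : Good (∈ᵇ mem)
      maximal  : ∀ x → ¬ (∈ᵇ mem) x → ∃ λ F → All (∈ᵇ mem) F × Bad (x ∷ F)

  module _ (S : Pred X 0ℓ) (S-good : Good S) where

    Extension : Set
    Extension = Σ (X → Bool) λ m → (∀ {x} → S x → (∈ᵇ m) x) × Good (∈ᵇ m)

    antisym : ∀ {a b} → (a ≡ true → b ≡ true) → (b ≡ true → a ≡ true) → a ≡ b
    antisym {false} {false} _ _ = refl
    antisym {true}  {true}  _ _ = refl
    antisym {false} {true}  _ g = g refl
    antisym {true}  {false} f _ = sym (f refl)

    poset : Poset 0ℓ 0ℓ 0ℓ
    poset = record
      { Carrier = Extension
      ; _≈_ = λ m n → ∀ x → proj₁ m x ≡ proj₁ n x
      ; _≤_ = λ m n → ∀ x → (∈ᵇ proj₁ m) x → (∈ᵇ proj₁ n) x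
      ; isPartialOrder = record
        { isPreorder = record
          { isEquivalence = record
            { refl = λ _ → refl ; sym = λ e x → sym (e x) ; trans = λ e f x → trans (e x) (f x) }
          ; reflexive = λ e x → trans (sym (e x))
          ; trans = λ f g x → g x ∘ f x
          }
        ; antisym = λ f g x → antisym (f x) (g x)
        }
      }
    open Poset poset using () renaming (_≤_ to _≼_)

    chain-bound : (C : Pred Extension 0ℓ) → (∀ {m n} → C m → C n → m ≼ n ⊎ n ≼ m) →
                  ∃ λ u → ∀ {m} → C m → m ≼ u
    chain-bound C chain = (comprehend U , comprehend⁺ U ∘ inj₁ , U-good) ,
                          λ {m} m∈C x x∈m → comprehend⁺ U (inj₂ (m , m∈C , x∈m))
      where
      U : Pred X 0ℓ
      -- `S` is included so that the empty chain has an upper bound as well.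
      U x = S x ⊎ ∃ λ m → C m × (∈ᵇ proj₁ m) x

      covered : ∀ F → All U F → All S F ⊎ ∃ λ m → C m × All (∈ᵇ proj₁ m) F
      covered [] [] = inj₁ []
      covered (x ∷ F) (u ∷ us) with u | covered F us
      ... | inj₁ s | inj₁ ss = inj₁ (s ∷ ss)
      ... | inj₁ s | inj₂ (m , m∈ , F⊆m) = inj₂ (m , m∈ , proj₁ (proj₂ m) s ∷ F⊆m)
      ... | inj₂ (m , m∈ , x∈m) | inj₁ ss = inj₂ (m , m∈ , x∈m ∷ All.map (proj₁ (proj₂ m)) ss)
      ... | inj₂ (m , m∈ , x∈m) | inj₂ (n , n∈ , F⊆n) with chain m∈ n∈
      ... | inj₁ m≼n = inj₂ (n , n∈ , m≼n _ x∈m ∷ F⊆n)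
      ... | inj₂ n≼m = inj₂ (m , m∈ , x∈m ∷ All.map (n≼m _) F⊆n)

      U-good : Good (∈ᵇ comprehend U)
      U-good F F⊆U with covered F (All.map (comprehend⁻ U) F⊆U)
      ... | inj₁ F⊆S           = S-good F F⊆S
      ... | inj₂ (m , _ , F⊆m) = proj₂ (proj₂ m) F F⊆m

    tukey : Maximal S
    tukey with zorn poset chain-bound
    ... | (m , S⊆m , m-good) , m-max =
      record { mem = m ; includes = S⊆m ; good = m-good ; maximal = maximal }
      where
      maximal : ∀ x → ¬ (∈ᵇ m) x → ∃ λ F → All (∈ᵇ m) F × Bad (x ∷ F)
      maximal x x∉m with em {∃ λ F → All (∈ᵇ m) F × Bad (x ∷ F)}
      ... | yes p = p
      ... | no ¬p = contradiction
          (trans (m-max {comprehend m⁺ , comprehend⁺ m⁺ ∘ inj₁ ∘ S⊆m , m⁺-good}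
                        (λ _ → comprehend⁺ m⁺ ∘ inj₁) x)
                 (comprehend⁺ m⁺ (inj₂ refl)))
          x∉m
        where
        m⁺ : Pred X 0ℓ
        m⁺ y = (∈ᵇ m) y ⊎ y ≡ x
        split : ∀ F → All m⁺ F → ∃ λ F′ → All (∈ᵇ m) F′ × F ⊆ x ∷ F′
        split [] [] = [] , [] , λ ()
        split (y ∷ F) (py ∷ ps) with py | split F ps
        ... | inj₁ y∈m  | F′ , F′⊆m , F⊆ =
          y ∷ F′ , y∈m ∷ F′⊆m , ∈-∷⁺ʳ (there (here refl)) (∷⁺ʳ x there ∘ F⊆)
        ... | inj₂ refl | F′ , F′⊆m , F⊆ = F′ , F′⊆m , ∈-∷⁺ʳ (here refl) F⊆
        m⁺-good : Good (∈ᵇ comprehend m⁺)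
        m⁺-good F F⊆ bad with split F (All.map (comprehend⁻ m⁺) F⊆)
        ... | F′ , F′⊆m , F⊆xF′ = ¬p (F′ , F′⊆m , mono F⊆xF′ bad)

module Calculus (em : ExcludedMiddle 0ℓ) (zorn : ZornsLemma 0ℓ)
  (L Var : Set) (infinite : Infinite L) where
  open LinearTense L Var (λ _ _ → em) infinite
  open Equivalence using (to; from)

  -- Labels and substitution

  upd-≡ : ∀ {a} {A : Set a} (f : L → A) {x a} → (f [ x ↦ a ]) x ≡ a
  upd-≡ _ {x} rewrite dec-true (em {x ≡ x}) refl = refl

  upd-≢ : ∀ {a} {A : Set a} (f : L → A) {x a y} → y ≢ x → (f [ x ↦ a ]) y ≡ f y
  upd-≢ _ {x} {y = y} y≢x rewrite dec-false (em {y ≡ x}) y≢x = refl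

  upd-cong : ∀ {a} {A : Set a} (f g : L → A) {x a b y} →
             (y ≡ x → a ≡ b) → (y ≢ x → f y ≡ g y) → (f [ x ↦ a ]) y ≡ (g [ x ↦ b ]) y
  upd-cong _ _ {x} {y = y} eq ne with em {y ≡ x}
  ... | yes y≡x = eq y≡x
  ... | no  y≢x = ne y≢x

  upd-∘ : ∀ {a b} {A : Set a} {B : Set b} (g : A → B) (f : L → A) {x c y} →
          g ((f [ x ↦ c ]) y) ≡ ((g ∘ f) [ x ↦ g c ]) y
  upd-∘ g f {x} {y = y} with em {y ≡ x}
  ... | yes _ = refl
  ... | no  _ = refl

  upd-id : ∀ {x y} → (id [ x ↦ x ]) y ≡ y
  upd-id {x} {y} with em {y ≡ x}
  ... | yes y≡x = sym y≡x
  ... | no  _   = refl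

  avoid-∉ : ∀ x xs → avoid x xs ∉ xs
  avoid-∉ x xs with DecMembership._∈?_ (λ _ _ → em) x xs
  ... | yes _   = proj₂ (infinite xs)
  ... | no  x∉  = x∉

  avoid-≡ : ∀ {x xs} → x ∉ xs → avoid x xs ≡ x
  avoid-≡ {x} {xs} x∉ rewrite dec-false (DecMembership._∈?_ (λ _ _ → em) x xs) x∉ = refl

  ∈-free-all⁺ : ∀ {x y} ρ → y ∈ freeR ρ → y ≢ x → y ∈ freeR (all x ρ)
  ∈-free-all⁺ _ = ∈-filter⁺ (λ y → ¬? em)

  ∈-free-all⁻ : ∀ {x y} ρ → y ∈ freeR (all x ρ) → y ∈ freeR ρ × y ≢ x
  ∈-free-all⁻ _ = ∈-filter⁻ (λ y → ¬? em)

  free⊆labels : ∀ φ → free φ ⊆ labels φ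
  free⊆labels (lwff (_ ∶ _)) = id
  free⊆labels (rwff ρ) = go ρ
    where
    go : ∀ ρ → freeR ρ ⊆ labelsR ρ
    go (_ < _)   = id
    go (_ ≐ _)   = id
    go (ρ ⊐ ρ′)  = [ ∈-++⁺ˡ ∘ go ρ , ∈-++⁺ʳ (labelsR ρ) ∘ go ρ′ ]′ ∘ ∈-++⁻ (freeR ρ)
    go (all x ρ) = there ∘ go ρ ∘ proj₁ ∘ ∈-free-all⁻ ρ

  subR-cong : ∀ {σ τ} ρ → (∀ {y} → y ∈ freeR ρ → σ y ≡ τ y) → subR σ ρ ≡ subR τ ρ
  subR-cong (x < y) σ≗τ = cong₂ _<_ (σ≗τ (here refl)) (σ≗τ (there (here refl)))
  subR-cong (x ≐ y) σ≗τ = cong₂ _≐_ (σ≗τ (here refl)) (σ≗τ (there (here refl)))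
  subR-cong ∅ σ≗τ = refl
  subR-cong (ρ ⊐ ρ′) σ≗τ =
    cong₂ _⊐_ (subR-cong ρ (σ≗τ ∘ ∈-++⁺ˡ)) (subR-cong ρ′ (σ≗τ ∘ ∈-++⁺ʳ (freeR ρ)))
  subR-cong {σ} {τ} (all x ρ) σ≗τ = cong₂ all z≡z′
    (subR-cong ρ λ y∈ → upd-cong σ τ (λ _ → z≡z′) (λ y≢x → σ≗τ (∈-free-all⁺ ρ y∈ y≢x)))
    where
    z≡z′ : avoid x (map σ (freeR (all x ρ))) ≡ avoid x (map τ (freeR (all x ρ)))
    z≡z′ = cong (avoid x) (map-cong-local (All.tabulate σ≗τ))

  subR-id : ∀ {σ} ρ → (∀ {y} → y ∈ freeR ρ → σ y ≡ y) → subR σ ρ ≡ ρ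
  subR-id ρ σ≗id = trans (subR-cong ρ σ≗id) (go ρ)
    where
    go : ∀ ρ → subR id ρ ≡ ρ
    go (x < y)   = refl
    go (x ≐ y)   = refl
    go ∅         = refl
    go (ρ ⊐ ρ′)  = cong₂ _⊐_ (go ρ) (go ρ′)
    go (all x ρ) = cong₂ all z≡x
      (trans (subR-cong ρ λ _ → trans (upd-cong id id (λ _ → z≡x) (λ _ → refl)) upd-id) (go ρ))
      where
      -- The bound label is never free in the quantified formula, so the identity causes no
      -- renaming.
      x∉ : x ∉ map id (freeR (all x ρ))
      x∉ x∈ with ∈-map⁻ id x∈
      ... | _ , x∈′ , refl = proj₂ (∈-free-all⁻ ρ x∈′) refl
      z≡x : avoid x (map id (freeR (all x ρ))) ≡ x
      z≡x = avoid-≡ x∉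

  binder : (L → L) → L → RWff → L
  binder σ x ρ = avoid x (map σ (freeR (all x ρ)))

  binder-≢ : ∀ {σ x y} ρ → y ∈ freeR (all x ρ) → σ y ≢ binder σ x ρ
  binder-≢ {σ} {x} ρ y∈ eq =
    avoid-∉ x (map σ (freeR (all x ρ))) (subst (_∈ map σ (freeR (all x ρ))) eq (∈-map⁺ σ y∈))

  ∈-free-sub⁻ : ∀ {σ y} ρ → y ∈ freeR (subR σ ρ) → ∃ λ x → x ∈ freeR ρ × y ≡ σ x
  ∈-free-sub⁻ (x < y) (here refl)         = x , here refl , refl
  ∈-free-sub⁻ (x < y) (there (here refl)) = y , there (here refl) , refl
  ∈-free-sub⁻ (x ≐ y) (here refl)         = x , here refl , refl
  ∈-free-sub⁻ (x ≐ y) (there (here refl)) = y , there (here refl) , refl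
  ∈-free-sub⁻ {σ} (ρ ⊐ ρ′) y∈ with ∈-++⁻ (freeR (subR σ ρ)) y∈
  ... | inj₁ y∈ρ  = let x , x∈ , eq = ∈-free-sub⁻ ρ y∈ρ in x , ∈-++⁺ˡ x∈ , eq
  ... | inj₂ y∈ρ′ = let x , x∈ , eq = ∈-free-sub⁻ ρ′ y∈ρ′ in x , ∈-++⁺ʳ (freeR ρ) x∈ , eq
  ∈-free-sub⁻ {σ} (all x ρ) y∈ with ∈-free-all⁻ (subR _ ρ) y∈
  ... | y∈′ , y≢z with ∈-free-sub⁻ ρ y∈′
  ... | u , u∈ , refl with em {u ≡ x}
  ... | yes u≡x = ⊥-elim (y≢z refl)
  ... | no  u≢x = u , ∈-free-all⁺ ρ u∈ u≢x , refl

  ∈-free-sub⁺ : ∀ {σ x} ρ → x ∈ freeR ρ → σ x ∈ freeR (subR σ ρ)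
  ∈-free-sub⁺ (x < y) (here refl)         = here refl
  ∈-free-sub⁺ (x < y) (there (here refl)) = there (here refl)
  ∈-free-sub⁺ (x ≐ y) (here refl)         = here refl
  ∈-free-sub⁺ (x ≐ y) (there (here refl)) = there (here refl)
  ∈-free-sub⁺ {σ} (ρ ⊐ ρ′) x∈ with ∈-++⁻ (freeR ρ) x∈
  ... | inj₁ x∈ρ  = ∈-++⁺ˡ (∈-free-sub⁺ ρ x∈ρ)
  ... | inj₂ x∈ρ′ = ∈-++⁺ʳ (freeR (subR σ ρ)) (∈-free-sub⁺ ρ′ x∈ρ′)
  ∈-free-sub⁺ {σ} {y} (all x ρ) y∈ with ∈-free-all⁻ ρ y∈
  ... | y∈ρ , y≢x = ∈-free-all⁺ (subR (σ [ x ↦ z ]) ρ)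
      (subst (_∈ freeR (subR (σ [ x ↦ z ]) ρ)) (upd-≢ σ y≢x) (∈-free-sub⁺ ρ y∈ρ))
      (binder-≢ {σ} ρ y∈)
    where z = binder σ x ρ

  -- Derived rules

  infix 3 _⊩_
  -- `Θ` only bounds the open assumptions. Hence weakening keeps the tree, and eigenlabel conditions
  -- can be checked on `Θ` instead of on the tree.
  _⊩_ : List Formula → Formula → Set
  Θ ⊩ φ = Σ (Deriv φ) λ d → ∀ ψ → Open d ψ → ψ ∈ Θ

  discharge : ∀ {P : Formula → Set} {χ Θ} → (∀ ψ → P ψ → ψ ∈ χ ∷ Θ) → ∀ ψ → P ψ × ψ ≢ χ → ψ ∈ Θ
  discharge f ψ (p , ψ≢χ) with f ψ p
  ... | here ψ≡χ = ⊥-elim (ψ≢χ ψ≡χ)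
  ... | there ψ∈ = ψ∈

  merge : ∀ {P Q : Formula → Set} {Θ} → (∀ ψ → P ψ → ψ ∈ Θ) → (∀ ψ → Q ψ → ψ ∈ Θ) →
          ∀ ψ → P ψ ⊎ Q ψ → ψ ∈ Θ
  merge f g ψ = [ f ψ , g ψ ]′

  fresh : ∀ {P : Formula → Set} {χ Θ} (lab : Formula → List L) {y} → (∀ ψ → P ψ → ψ ∈ χ ∷ Θ) →
          (∀ {ψ} → ψ ∈ Θ → y ∉ lab ψ) → ∀ ψ → P ψ → ψ ≢ χ → y ∉ lab ψ
  fresh _ f y∉ ψ p ψ≢χ = y∉ (discharge f ψ (p , ψ≢χ))

  hyp : ∀ {Θ φ} → φ ∈ Θ → Θ ⊩ φ
  hyp φ∈ = assume _ , λ { _ refl → φ∈ }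

  hyp₀ : ∀ {Θ φ} → φ ∷ Θ ⊩ φ
  hyp₀ = hyp (here refl)

  hyp₁ : ∀ {Θ φ ψ} → ψ ∷ φ ∷ Θ ⊩ φ
  hyp₁ = hyp (there (here refl))

  hyp₂ : ∀ {Θ φ ψ χ} → χ ∷ ψ ∷ φ ∷ Θ ⊩ φ
  hyp₂ = hyp (there (there (here refl)))

  weaken : ∀ {Θ Θ′ φ} → Θ ⊆ Θ′ → Θ ⊩ φ → Θ′ ⊩ φ
  weaken Θ⊆ (d , o) = d , λ ψ → Θ⊆ ∘ o ψ

  raa⊥ : ∀ {Θ x y A} → lwff (x ∶ A ⊃ ⊥′) ∷ Θ ⊩ lwff (y ∶ ⊥′) → Θ ⊩ lwff (x ∶ A)
  raa⊥ (d , o) = RAA⊥ d , discharge o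

  ⊃i : ∀ {Θ x A B} → lwff (x ∶ A) ∷ Θ ⊩ lwff (x ∶ B) → Θ ⊩ lwff (x ∶ A ⊃ B)
  ⊃i (d , o) = ⊃I d , discharge o

  ⊃e : ∀ {Θ x A B} → Θ ⊩ lwff (x ∶ A ⊃ B) → Θ ⊩ lwff (x ∶ A) → Θ ⊩ lwff (x ∶ B)
  ⊃e (d , o) (d′ , o′) = ⊃E d d′ , merge o o′

  gi : ∀ {Θ x y A} → y ≢ x → (∀ {ψ} → ψ ∈ Θ → y ∉ labels ψ) →
       rwff (x < y) ∷ Θ ⊩ lwff (y ∶ A) → Θ ⊩ lwff (x ∶ G A)
  gi y≢x y∉ (d , o) = GI d y≢x (fresh labels o y∉) , discharge o

  ge : ∀ {Θ x y A} → Θ ⊩ lwff (x ∶ G A) → Θ ⊩ rwff (x < y) → Θ ⊩ lwff (y ∶ A)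
  ge (d , o) (d′ , o′) = GE d d′ , merge o o′

  hi : ∀ {Θ x y A} → y ≢ x → (∀ {ψ} → ψ ∈ Θ → y ∉ labels ψ) →
       rwff (y < x) ∷ Θ ⊩ lwff (y ∶ A) → Θ ⊩ lwff (x ∶ H A)
  hi y≢x y∉ (d , o) = HI d y≢x (fresh labels o y∉) , discharge o

  he : ∀ {Θ x y A} → Θ ⊩ lwff (x ∶ H A) → Θ ⊩ rwff (y < x) → Θ ⊩ lwff (y ∶ A)
  he (d , o) (d′ , o′) = HE d d′ , merge o o′

  raa∅ : ∀ {Θ ρ} → rwff (~ ρ) ∷ Θ ⊩ rwff ∅ → Θ ⊩ rwff ρ
  raa∅ (d , o) = RAA∅ d , discharge o

  ⊐i : ∀ {Θ ρ ρ′} → rwff ρ ∷ Θ ⊩ rwff ρ′ → Θ ⊩ rwff (ρ ⊐ ρ′)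
  ⊐i (d , o) = ⊐I d , discharge o

  ⊐e : ∀ {Θ ρ ρ′} → Θ ⊩ rwff (ρ ⊐ ρ′) → Θ ⊩ rwff ρ → Θ ⊩ rwff ρ′
  ⊐e (d , o) (d′ , o′) = ⊐E d d′ , merge o o′

  ∀i : ∀ {Θ x ρ} → (∀ {ψ} → ψ ∈ Θ → x ∉ free ψ) → Θ ⊩ rwff ρ → Θ ⊩ rwff (all x ρ)
  ∀i x∉ (d , o) = ∀I d (λ ψ p → x∉ (o ψ p)) , o

  ∀e : ∀ {Θ x ρ} y → Θ ⊩ rwff (all x ρ) → Θ ⊩ rwff ρ [ y / x ]
  ∀e y (d , o) = ∀E y d , o

  repl : ∀ {Θ φ x y} → Θ ⊩ φ → Θ ⊩ rwff (x ≐ y) → Θ ⊩ φ [ y / x ]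
  repl (d , o) (d′ , o′) = mon d d′ , merge o o′

  ⊥⇒∅ : ∀ {Θ x} → Θ ⊩ lwff (x ∶ ⊥′) → Θ ⊩ rwff ∅
  ⊥⇒∅ (d , o) = uf1 d , o

  ∅⇒⊥ : ∀ {Θ x} → Θ ⊩ rwff ∅ → Θ ⊩ lwff (x ∶ ⊥′)
  ∅⇒⊥ (d , o) = uf2 d , o

  ex-falso : ∀ {Θ ρ} → Θ ⊩ rwff ∅ → Θ ⊩ rwff ρ
  ex-falso = raa∅ ∘ weaken there

  cut : ∀ {Θ ρ φ} → Θ ⊩ rwff ρ → rwff ρ ∷ Θ ⊩ rwff φ → Θ ⊩ rwff φ
  cut d e = ⊐e (⊐i e) d

  infix 3 _⊢₁_
  _⊢₁_ : RWff → RWff → Set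
  ρ ⊢₁ ρ′ = rwff ρ ∷ [] ⊩ rwff ρ′

  apply : ∀ {Θ ρ ρ′} → ρ ⊢₁ ρ′ → Θ ⊩ rwff ρ → Θ ⊩ rwff ρ′
  apply {ρ = ρ} e d = cut d (weaken (∷⁺ʳ (rwff ρ) λ ()) e)

  ∉-free-[all] : ∀ {x} ρ {ψ} → ψ ∈ rwff (all x ρ) ∷ [] → x ∉ free ψ
  ∉-free-[all] ρ (here refl) x∈ = proj₂ (∈-free-all⁻ ρ x∈) refl

  all-mono : ∀ {x ρ ρ′} → ρ ⊢₁ ρ′ → all x ρ ⊢₁ all x ρ′
  all-mono {x} {ρ} e = ∀i (∉-free-[all] ρ)
    (apply e (subst (λ ρ′ → rwff (all x ρ) ∷ [] ⊩ rwff ρ′) (subR-id ρ λ _ → upd-id) (∀e x hyp₀)))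

  ⊐-mono : ∀ {ρ₁ ρ₁′ ρ₂ ρ₂′} → ρ₁′ ⊢₁ ρ₁ → ρ₂ ⊢₁ ρ₂′ → ρ₁ ⊐ ρ₂ ⊢₁ ρ₁′ ⊐ ρ₂′
  ⊐-mono e₁ e₂ = ⊐i (apply e₂ (⊐e hyp₁ (apply e₁ hyp₀)))

  -- Composition of substitutions and change of bound labels

  -- Up to interderivability, all z (subR θ ρ) is the result of applying σ to
  -- all x ρ.
  Binds : (L → L) → L → RWff → L → (L → L) → Set
  Binds σ x ρ z θ = θ x ≡ z × (∀ {y} → y ∈ freeR ρ → y ≢ x → θ y ≡ σ y × σ y ≢ z)

  -- Composing substitutions may change the names of bound labels, so the
  -- two results are only interderivable.
  Composable : RWff → Set
  Composable ρ = ∀ σ τ →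
    (subR τ (subR σ ρ) ⊢₁ subR (τ ∘ σ) ρ) × (subR (τ ∘ σ) ρ ⊢₁ subR τ (subR σ ρ))

  Binds-fresh : ∀ {σ x z} ρ → (∀ {y} → y ∈ freeR (all x ρ) → σ y ≢ z) → Binds σ x ρ z (σ [ x ↦ z ])
  Binds-fresh {σ} ρ z# = upd-≡ σ , λ y∈ y≢x → upd-≢ σ y≢x , z# (∈-free-all⁺ ρ y∈ y≢x)

  module _ {ρ} (comp : Composable ρ) where

    -- `∀E` substitutes into a body that is already a substitution instance, so composability of the
    -- body is what turns the result into one substitution. It is a module parameter because
    -- `composable` calls these lemmas within its own induction.
    instantiate : ∀ {σ x z θ} a → Binds σ x ρ z θ → all z (subR θ ρ) ⊢₁ subR (σ [ x ↦ a ]) ρ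
    instantiate {σ} {x} {z} {θ} a (θx≡z , θ≗σ) =
      subst (λ ρ′ → rwff (all z (subR θ ρ)) ∷ [] ⊩ rwff ρ′) (subR-cong ρ agree)
        (apply (proj₁ (comp θ (id [ z ↦ a ]))) (∀e a hyp₀))
      where
      agree : ∀ {y} → y ∈ freeR ρ → (id [ z ↦ a ]) (θ y) ≡ (σ [ x ↦ a ]) y
      agree {y} y∈ with em {y ≡ x}
      ... | yes refl = trans (cong (id [ z ↦ a ]) θx≡z) (upd-≡ id)
      ... | no  y≢x  = let θy≡σy , σy≢z = θ≗σ y∈ y≢x in
        trans (cong (id [ z ↦ a ]) θy≡σy) (upd-≢ id σy≢z)

    rename-binder : ∀ {σ x z z′ θ θ′} → Binds σ x ρ z θ → Binds σ x ρ z′ θ′ →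
                    all z (subR θ ρ) ⊢₁ all z′ (subR θ′ ρ)
    rename-binder {σ} {x} {z} {z′} {θ} {θ′} b@(θx≡z , θ≗σ) (θ′x≡z′ , θ′≗σ) =
      ∀i z′∉ (subst (λ ρ′ → rwff (all z (subR θ ρ)) ∷ [] ⊩ rwff ρ′) (subR-cong ρ agree)
        (instantiate z′ b))
      where
      agree : ∀ {y} → y ∈ freeR ρ → (σ [ x ↦ z′ ]) y ≡ θ′ y
      agree {y} y∈ with em {y ≡ x}
      ... | yes refl = sym θ′x≡z′
      ... | no  y≢x  = sym (proj₁ (θ′≗σ y∈ y≢x))
      z′∉ : ∀ {ψ} → ψ ∈ rwff (all z (subR θ ρ)) ∷ [] → z′ ∉ free ψ
      z′∉ (here refl) z′∈ with ∈-free-all⁻ (subR θ ρ) z′∈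
      ... | z′∈θρ , z′≢z with ∈-free-sub⁻ ρ z′∈θρ
      ... | y , y∈ , z′≡θy with em {y ≡ x}
      ... | yes refl = z′≢z (trans z′≡θy θx≡z)
      ... | no  y≢x  = proj₂ (θ′≗σ y∈ y≢x) (trans (sym (proj₁ (θ≗σ y∈ y≢x))) (sym z′≡θy))

  composable : ∀ ρ → Composable ρ
  composable (x < y) σ τ = hyp₀ , hyp₀
  composable (x ≐ y) σ τ = hyp₀ , hyp₀
  composable ∅       σ τ = hyp₀ , hyp₀
  composable (ρ ⊐ ρ′) σ τ =
    let fwd , bwd = composable ρ σ τ ; fwd′ , bwd′ = composable ρ′ σ τ in
    ⊐-mono bwd fwd′ , ⊐-mono fwd bwd′
  -- By `ih`, the bodies agree up to interderivability. What remains is that two successive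
  -- substitutions may choose another bound label than their composite; both choices satisfy
  -- `Binds`.
  composable (all x ρ) σ τ =
    apply (rename-binder (composable ρ) b₂ b) (all-mono (proj₁ ih)) ,
    apply (all-mono (proj₂ ih)) (rename-binder (composable ρ) b b₂)
    where
    z₁ = binder σ x ρ
    σ₁ = σ [ x ↦ z₁ ]
    z₂ = binder τ z₁ (subR σ₁ ρ)
    τ₂ = τ [ z₁ ↦ z₂ ]
    ih = composable ρ σ₁ τ₂
    b : Binds (τ ∘ σ) x ρ (binder (τ ∘ σ) x ρ) ((τ ∘ σ) [ x ↦ binder (τ ∘ σ) x ρ ])
    b = Binds-fresh ρ (binder-≢ ρ)
    b₂ : Binds (τ ∘ σ) x ρ z₂ (τ₂ ∘ σ₁)
    b₂ = trans (cong τ₂ (upd-≡ σ)) (upd-≡ τ) , λ {y} y∈ y≢x →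
      let y∈′ = ∈-free-all⁺ ρ y∈ y≢x
          σy∈ = ∈-free-all⁺ (subR σ₁ ρ)
                  (subst (_∈ freeR (subR σ₁ ρ)) (upd-≢ σ y≢x) (∈-free-sub⁺ ρ y∈)) (binder-≢ ρ y∈′)
      in trans (cong τ₂ (upd-≢ σ y≢x)) (upd-≢ τ (binder-≢ ρ y∈′)) , binder-≢ (subR σ₁ ρ) σy∈

  all-elim : ∀ {Θ σ x} ρ a → Θ ⊩ rwff (subR σ (all x ρ)) → Θ ⊩ rwff (subR (σ [ x ↦ a ]) ρ)
  all-elim ρ a = apply (instantiate (composable ρ) a (Binds-fresh ρ (binder-≢ ρ)))

  all-intro : ∀ {Θ σ x z} ρ → (∀ {ψ} → ψ ∈ Θ → z ∉ free ψ) →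
              (∀ {y} → y ∈ freeR (all x ρ) → σ y ≢ z) →
              Θ ⊩ rwff (subR (σ [ x ↦ z ]) ρ) → Θ ⊩ rwff (subR σ (all x ρ))
  all-intro ρ z∉ z# d =
    apply (rename-binder (composable ρ) (Binds-fresh ρ z#) (Binds-fresh ρ (binder-≢ ρ))) (∀i z∉ d)

  -- Soundness

  module _ (M : Model) where
    open Model M renaming (trans to ≺-trans)

    TrueR-cong : ∀ {f g} ρ → (∀ {y} → y ∈ freeR ρ → f y ≡ g y) → TrueR M f ρ → TrueR M g ρ
    TrueR-cong (x < y) f≗g = subst₂ _≺_ (f≗g (here refl)) (f≗g (there (here refl)))
    TrueR-cong (x ≐ y) f≗g = subst₂ _≡_ (f≗g (here refl)) (f≗g (there (here refl)))
    TrueR-cong ∅       f≗g = id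
    TrueR-cong (ρ ⊐ ρ′) f≗g t =
      TrueR-cong ρ′ (f≗g ∘ ∈-++⁺ʳ (freeR ρ)) ∘ t ∘ TrueR-cong ρ (sym ∘ f≗g ∘ ∈-++⁺ˡ)
    TrueR-cong {f} {g} (all x ρ) f≗g t w = TrueR-cong ρ
      (λ y∈ → upd-cong f g (λ _ → refl) (λ y≢x → f≗g (∈-free-all⁺ ρ y∈ y≢x))) (t w)

    -- In `TrueL` the clauses for `G` and `H` pass through an auxiliary label. Truth in this form
    -- depends on the world alone, which gives `TrueL-cong` without an induction that tracks
    -- interpretations.
    Sat : W → Kl → Set
    Sat w (var p) = V w p ≡ true
    Sat w ⊥′      = ⊥
    Sat w (A ⊃ B) = Sat w A → Sat w B
    Sat w (G A)   = ∀ v → w ≺ v → Sat v A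
    Sat w (H A)   = ∀ v → v ≺ w → Sat v A

    other : ∀ x → ∃ λ (y : L) → y ≢ x
    other x = let y , y∉ = infinite (x ∷ []) in y , y∉ ∘ here

    TrueL⇔Sat : ∀ {f x} A → TrueL M f x A ⇔ Sat (f x) A
    TrueL⇔Sat (var p) = mk⇔ id id
    TrueL⇔Sat ⊥′      = mk⇔ id id
    TrueL⇔Sat (A ⊃ B) = mk⇔
      (λ t → to (TrueL⇔Sat B) ∘ t ∘ from (TrueL⇔Sat A))
      (λ s → from (TrueL⇔Sat B) ∘ s ∘ to (TrueL⇔Sat A))
    TrueL⇔Sat {f} {x} (G A) = mk⇔
      (λ t w x≺w → let y , y≢x = other x in
        subst (λ v → Sat v A) (upd-≡ f) (to (TrueL⇔Sat A) (t w x≺w y y≢x)))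
      (λ s w x≺w y y≢x → from (TrueL⇔Sat A)
        (subst (λ v → Sat v A) (sym (upd-≡ f)) (s w x≺w)))
    TrueL⇔Sat {f} {x} (H A) = mk⇔
      (λ t w w≺x → let y , y≢x = other x in
        subst (λ v → Sat v A) (upd-≡ f) (to (TrueL⇔Sat A) (t w w≺x y y≢x)))
      (λ s w w≺x y y≢x → from (TrueL⇔Sat A)
        (subst (λ v → Sat v A) (sym (upd-≡ f)) (s w w≺x)))

    TrueL-cong : ∀ {f g x y} A → f x ≡ g y → TrueL M f x A → TrueL M g y A
    TrueL-cong A fx≡gy =
      from (TrueL⇔Sat A) ∘ subst (λ w → Sat w A) fx≡gy ∘ to (TrueL⇔Sat A)

    True-cong : ∀ {f g} φ → (∀ {y} → y ∈ free φ → f y ≡ g y) → True M f φ → True M g φ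
    True-cong (lwff (x ∶ A)) f≗g = TrueL-cong A (f≗g (here refl))
    True-cong (rwff ρ)       f≗g = TrueR-cong ρ f≗g

    True-fresh : ∀ {f x w} φ → x ∉ free φ → True M f φ → True M (f [ x ↦ w ]) φ
    True-fresh {f} {x} {w} φ x∉ = True-cong φ λ {y} y∈ →
      sym (upd-≢ f {x} {w} {y} λ { refl → x∉ y∈ })

    TrueR-sub : ∀ {f σ} ρ → TrueR M f (subR σ ρ) ⇔ TrueR M (f ∘ σ) ρ
    TrueR-sub (x < y)  = mk⇔ id id
    TrueR-sub (x ≐ y)  = mk⇔ id id
    TrueR-sub ∅        = mk⇔ id id
    TrueR-sub (ρ ⊐ ρ′) = mk⇔
      (λ t → to (TrueR-sub ρ′) ∘ t ∘ from (TrueR-sub ρ))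
      (λ t → from (TrueR-sub ρ′) ∘ t ∘ to (TrueR-sub ρ))
    TrueR-sub {f} {σ} (all x ρ) = mk⇔
      (λ t w → TrueR-cong ρ (agree w) (to (TrueR-sub ρ) (t w)))
      (λ t w → from (TrueR-sub ρ) (TrueR-cong ρ (sym ∘ agree w) (t w)))
      where
      z = binder σ x ρ
      agree : ∀ w {y} → y ∈ freeR ρ → (f [ z ↦ w ]) ((σ [ x ↦ z ]) y) ≡ ((f ∘ σ) [ x ↦ w ]) y
      agree w {y} y∈ with em {y ≡ x}
      ... | yes _   = upd-≡ f
      ... | no  y≢x = upd-≢ f (binder-≢ ρ (∈-free-all⁺ ρ y∈ y≢x))

    True-sub : ∀ {f σ} φ → True M f (sub σ φ) ⇔ True M (f ∘ σ) φ
    True-sub (lwff (x ∶ A)) = mk⇔ (TrueL-cong A refl) (TrueL-cong A refl)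
    True-sub (rwff ρ)       = TrueR-sub ρ

    Assumed : Interpretation M → Pred Formula 0ℓ → Set
    Assumed f P = ∀ ψ → P ψ → True M f ψ

    left : ∀ {f} {P Q : Pred Formula 0ℓ} → Assumed f (λ ψ → P ψ ⊎ Q ψ) → Assumed f P
    left as ψ = as ψ ∘ inj₁

    right : ∀ {f} {P Q : Pred Formula 0ℓ} → Assumed f (λ ψ → P ψ ⊎ Q ψ) → Assumed f Q
    right as ψ = as ψ ∘ inj₂

    restore : ∀ {f χ} {P : Pred Formula 0ℓ} → Assumed f (λ ψ → P ψ × ψ ≢ χ) → True M f χ →
              Assumed f P
    restore {χ = χ} as t ψ p with em {ψ ≡ χ}
    ... | yes refl = t
    ... | no  ψ≢χ  = as ψ (p , ψ≢χ)

    Assumed-fresh : ∀ {f x w χ} (P : Pred Formula 0ℓ) → (∀ ψ → P ψ → ψ ≢ χ → x ∉ labels ψ) →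
                    Assumed f (λ ψ → P ψ × ψ ≢ χ) → Assumed (f [ x ↦ w ]) (λ ψ → P ψ × ψ ≢ χ)
    Assumed-fresh P x∉ as ψ (p , ψ≢χ) = True-fresh ψ (x∉ ψ p ψ≢χ ∘ free⊆labels ψ) (as ψ (p , ψ≢χ))

    sound : ∀ {φ} (d : Deriv φ) f → Assumed f (Open d) → True M f φ
    sound (assume φ) f as = as φ refl
    sound (RAA⊥ {x} {y} {A} d) f as = from (TrueL⇔Sat A) (decidable-stable em λ ¬s →
      sound d f (restore as (¬s ∘ to (TrueL⇔Sat A))))
    sound (⊃I d) f as t = sound d f (restore as t)
    sound (⊃E d e) f as = sound d f (left as) (sound e f (right as))
    -- The premise speaks of the eigenlabel `y`, the semantic clause of an arbitrary `z`. The
    -- premise is evaluated with `y` sent to `w`, and only the common world `w` matters.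
    sound (GI {x} {y} {A} d y≢x y∉) f as w x≺w z z≢x =
      TrueL-cong A (trans (upd-≡ f) (sym (upd-≡ f)))
        (sound d (f [ y ↦ w ]) (restore (Assumed-fresh (Open d) y∉ as)
          (subst₂ _≺_ (sym (upd-≢ f (y≢x ∘ sym))) (sym (upd-≡ f)) x≺w)))
    sound (GE {A = A} d e) f as =
      from (TrueL⇔Sat A)
        (to (TrueL⇔Sat (G A)) (sound d f (left as)) _
          (sound e f (right as)))
    sound (HI {x} {y} {A} d y≢x y∉) f as w w≺x z z≢x =
      TrueL-cong A (trans (upd-≡ f) (sym (upd-≡ f)))
        (sound d (f [ y ↦ w ]) (restore (Assumed-fresh (Open d) y∉ as)
          (subst₂ _≺_ (sym (upd-≡ f)) (sym (upd-≢ f (y≢x ∘ sym))) w≺x)))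
    sound (HE {A = A} d e) f as =
      from (TrueL⇔Sat A)
        (to (TrueL⇔Sat (H A)) (sound d f (left as)) _
          (sound e f (right as)))
    sound (RAA∅ d) f as = decidable-stable em λ ¬t → sound d f (restore as ¬t)
    sound (⊐I d) f as t = sound d f (restore as t)
    sound (⊐E d e) f as = sound d f (left as) (sound e f (right as))
    sound (∀I {x} d x∉) f as w =
      sound d (f [ x ↦ w ]) λ ψ p → True-fresh ψ (x∉ ψ p) (as ψ p)
    sound (∀E {x} {ρ} y d) f as = from (TrueR-sub ρ)
      (TrueR-cong ρ (λ _ → sym (upd-∘ f id)) (sound d f as (f y)))
    sound (ax-refl x) f as w = refl
    sound (ax-irrefl x) f as w = irrefl refl
    sound (ax-trans x y z x≢y y≢z x≢z) f as u v w both =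
      -- The encoded conjunction yields its two parts only on the way to a contradiction, so the
      -- goal is negated first.
      decidable-stable em λ ¬x<z → both λ x<y y<z → ¬x<z (subst₂ _≺_ (sym x↦u) (sym z↦w)
        (≺-trans (subst₂ _≺_ x↦u y↦v x<y) (subst₂ _≺_ y↦v z↦w y<z)))
      where
      f₁ = f [ x ↦ u ]
      f₂ = f₁ [ y ↦ v ]
      x↦u : (f₂ [ z ↦ w ]) x ≡ u
      x↦u = trans (upd-≢ f₂ x≢z) (trans (upd-≢ f₁ x≢y) (upd-≡ f))
      y↦v : (f₂ [ z ↦ w ]) y ≡ v
      y↦v = trans (upd-≢ f₂ y≢z) (upd-≡ f₁)
      z↦w : (f₂ [ z ↦ w ]) z ≡ w
      z↦w = upd-≡ f₂
    sound (ax-connected x y x≢y) f as u v x≮y x≠y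
      with connected (((f [ x ↦ u ]) [ y ↦ v ]) x) (((f [ x ↦ u ]) [ y ↦ v ]) y)
    ... | inj₁ x=y        = ⊥-elim (x≠y x=y)
    ... | inj₂ (inj₁ x<y) = ⊥-elim (x≮y x<y)
    ... | inj₂ (inj₂ y<x) = y<x
    sound (mon {φ} {x} {y} d e) f as = from (True-sub φ)
      (True-cong φ agree (sound d f (left as)))
      where
      agree : ∀ {u} → u ∈ free φ → f u ≡ f ((id [ x ↦ y ]) u)
      agree {u} _ with em {u ≡ x}
      ... | yes refl = sound e f (right as)
      ... | no  _    = refl
    sound (uf1 d) f as = sound d f as
    sound (uf2 d) f as = sound d f as

  -- Order and equality of labels

  eq-refl : ∀ {Θ} x → Θ ⊩ rwff (x ≐ x)
  eq-refl x = subst (λ y → _ ⊩ rwff (y ≐ y)) (upd-≡ id) (∀e {x = x} x (ax-refl x , λ _ ()))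

  -- `mon` replaces all occurrences of `x`, so one side of `x = x` cannot be rewritten alone.
  -- Instead, the negated goal is rewritten to the negation of `y = y`.
  eq-sym : ∀ {Θ x y} → Θ ⊩ rwff (x ≐ y) → Θ ⊩ rwff (y ≐ x)
  eq-sym {Θ} {x} {y} d with em {y ≡ x}
  ... | yes refl = d
  ... | no  y≢x  = raa∅ (⊐e
    (subst₂ (λ a b → _ ⊩ rwff (~ (a ≐ b))) (upd-≢ id y≢x) (upd-≡ id)
      (repl hyp₀ (weaken there d)))
    (eq-refl y))

  eq-trans : ∀ {Θ x y z} → Θ ⊩ rwff (x ≐ y) → Θ ⊩ rwff (y ≐ z) → Θ ⊩ rwff (x ≐ z)
  eq-trans {Θ} {x} {y} d e with em {x ≡ y}
  ... | yes refl = e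
  ... | no  x≢y  = subst₂ (λ a b → Θ ⊩ rwff (a ≐ b)) (upd-≢ id x≢y) (upd-≡ id) (repl d e)

  lt-irrefl : ∀ {Θ x} → Θ ⊩ rwff (x < x) → Θ ⊩ rwff ∅
  lt-irrefl {x = x} = ⊐e (subst (λ y → _ ⊩ rwff (~ (y < y))) (upd-≡ id)
    (∀e {x = x} x (ax-irrefl x , λ _ ())))

  lt-respˡ : ∀ {Θ x x′ y} → Θ ⊩ rwff (x < y) → Θ ⊩ rwff (x ≐ x′) → Θ ⊩ rwff (x′ < y)
  lt-respˡ {Θ} {x} {y = y} d e with em {y ≡ x}
  -- Here `mon` would change both sides, but `x < x` is already contradictory.
  ... | yes refl = ex-falso (lt-irrefl d)
  ... | no  y≢x  = subst₂ (λ a b → Θ ⊩ rwff (a < b)) (upd-≡ id) (upd-≢ id y≢x) (repl d e)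

  lt-respʳ : ∀ {Θ x y y′} → Θ ⊩ rwff (x < y) → Θ ⊩ rwff (y ≐ y′) → Θ ⊩ rwff (x < y′)
  lt-respʳ {Θ} {x} {y} d e with em {x ≡ y}
  ... | yes refl = ex-falso (lt-irrefl d)
  ... | no  x≢y  = subst₂ (λ a b → Θ ⊩ rwff (a < b)) (upd-≢ id x≢y) (upd-≡ id) (repl d e)

  lab-resp : ∀ {Θ x y A} → Θ ⊩ lwff (x ∶ A) → Θ ⊩ rwff (x ≐ y) → Θ ⊩ lwff (y ∶ A)
  lab-resp {Θ} {A = A} d e = subst (λ a → Θ ⊩ lwff (a ∶ A)) (upd-≡ id) (repl d e)

  module Variables where
    x y z : L
    x = proj₁ (infinite [])
    y = proj₁ (infinite (x ∷ []))
    z = proj₁ (infinite (x ∷ y ∷ []))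
    x≢y : x ≢ y
    x≢y e = proj₂ (infinite (x ∷ [])) (here (sym e))
    x≢z : x ≢ z
    x≢z e = proj₂ (infinite (x ∷ y ∷ [])) (here (sym e))
    y≢z : y ≢ z
    y≢z e = proj₂ (infinite (x ∷ y ∷ [])) (there (here (sym e)))

  -- Starting from the identity substitution, successive uses of `all-elim` extend one substitution,
  -- so nothing has to be composed.
  open-subR : ∀ {Θ} ρ → Θ ⊩ rwff ρ → Θ ⊩ rwff (subR id ρ)
  open-subR ρ = subst (λ ρ′ → _ ⊩ rwff ρ′) (sym (subR-id ρ λ _ → refl))

  lt-trans : ∀ {Θ a b c} → Θ ⊩ rwff (a < b) → Θ ⊩ rwff (b < c) → Θ ⊩ rwff (a < c)
  lt-trans {Θ} {a} {b} {c} d e = ⊐e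
      (subst₂ (λ a b → Θ ⊩ rwff (a < b ⊓ b < c ⊐ a < c)) x↦a y↦b
        (subst (λ c → Θ ⊩ rwff (σ x < σ y ⊓ σ y < c ⊐ σ x < c)) z↦c
          (all-elim _ c (all-elim _ b (all-elim _ a
            (open-subR _ (ax-trans x y z x≢y y≢z x≢z , λ _ ())))))))
      (⊐i (⊐e (⊐e hyp₀ (weaken there d)) (weaken there e)))
    where
    open Variables
    σ₁ = id [ x ↦ a ]
    σ₂ = σ₁ [ y ↦ b ]
    σ  = σ₂ [ z ↦ c ]
    x↦a : σ x ≡ a
    x↦a = trans (upd-≢ σ₂ x≢z) (trans (upd-≢ σ₁ x≢y) (upd-≡ id))
    y↦b : σ y ≡ b
    y↦b = trans (upd-≢ σ₂ y≢z) (upd-≡ σ₁)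
    z↦c : σ z ≡ c
    z↦c = upd-≡ σ₂

  lt-connected : ∀ {Θ} a b → rwff (a ≐ b) ∷ Θ ⊩ rwff ∅ → rwff (a < b) ∷ Θ ⊩ rwff ∅ →
                 rwff (b < a) ∷ Θ ⊩ rwff ∅ → Θ ⊩ rwff ∅
  lt-connected {Θ} a b a≠b a≮b b≮a = cut
      (⊐e (⊐e (subst₂ (λ a b → Θ ⊩ rwff (a < b ⊔ a ≐ b ⊔ b < a)) x↦a y↦b
                (all-elim _ b (all-elim _ a (open-subR _ (ax-connected x y x≢y , λ _ ())))))
              (⊐i a≮b))
          (⊐i a≠b))
      b≮a
    where
    open Variables
    σ₁ = id [ x ↦ a ]
    x↦a : (σ₁ [ y ↦ b ]) x ≡ a
    x↦a = trans (upd-≢ σ₁ x≢y) (upd-≡ id)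
    y↦b : (σ₁ [ y ↦ b ]) y ≡ b
    y↦b = upd-≡ σ₁

  -- A cut on a formula of either kind. In the labeled case no implication can end in ∅, so the goal
  -- goes to `x : ⊥` by `uf2` and returns by `uf1`.
  refute : ∀ {Θ φ} → Θ ⊩ φ → φ ∷ Θ ⊩ rwff ∅ → Θ ⊩ rwff ∅
  refute {φ = lwff (x ∶ A)} d e = ⊥⇒∅ (⊃e (⊃i (∅⇒⊥ e)) d)
  refute {φ = rwff ρ}       d e = cut d e

  -- Henkin constants

  -- The mutual definition gives all stages of the usual iterated Henkin extension at once: items
  -- may mention witnesses of other items.
  data C : Set
  data Item : Set

  data C where
    base : L → C
    wit  : Item → C

  data Item where
    fut past : C → Kl → Item
    inst     : (L → C) → L → RWff → Item

  infix 8 _<ᶜ_ _≐ᶜ_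
  infix 4 _∶ᶜ_

  -- A relational formula over C keeps its labels and comes with the constants
  -- they stand for, which avoids substitution into it.
  data Closure : Set where
    _<ᶜ_ _≐ᶜ_ : C → C → Closure
    _∶ᶜ_      : C → Kl → Closure
    rel       : (L → C) → RWff → Closure

  pos : Item → Closure
  pos (fut c A)    = c ∶ᶜ G A
  pos (past c A)   = c ∶ᶜ H A
  pos (inst e x ρ) = rel e (all x ρ)

  wits : Item → List Closure
  wits h@(fut c A)    = (wit h ∶ᶜ A ⊃ ⊥′) ∷ (c <ᶜ wit h) ∷ []
  wits h@(past c A)   = (wit h ∶ᶜ A ⊃ ⊥′) ∷ (wit h <ᶜ c) ∷ []
  wits h@(inst e x ρ) = rel (e [ x ↦ wit h ]) (~ ρ) ∷ []

  constants : Closure → List C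
  constants (c <ᶜ d)  = c ∷ d ∷ []
  constants (c ≐ᶜ d)  = c ∷ d ∷ []
  constants (c ∶ᶜ A)  = c ∷ []
  constants (rel e ρ) = map e (freeR ρ)

  tr : (C → L) → Closure → Formula
  tr r (c <ᶜ d)  = rwff (r c < r d)
  tr r (c ≐ᶜ d)  = rwff (r c ≐ r d)
  tr r (c ∶ᶜ A)  = lwff (r c ∶ A)
  tr r (rel e ρ) = rwff (subR (r ∘ e) ρ)

  tr-cong : ∀ {r s} φ → (∀ {c} → c ∈ constants φ → r c ≡ s c) → tr r φ ≡ tr s φ
  tr-cong (c <ᶜ d)  r≗s = cong₂ (λ a b → rwff (a < b)) (r≗s (here refl)) (r≗s (there (here refl)))
  tr-cong (c ≐ᶜ d)  r≗s = cong₂ (λ a b → rwff (a ≐ b)) (r≗s (here refl)) (r≗s (there (here refl)))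
  tr-cong (c ∶ᶜ A)  r≗s = cong (λ a → lwff (a ∶ A)) (r≗s (here refl))
  tr-cong (rel e ρ) r≗s = cong rwff (subR-cong ρ (r≗s ∘ ∈-map⁺ e))

  -- A witness lies strictly above the constants of its item, hence is not among them. Only labels
  -- free in `ρ` count, since `e` is defined on all of `L`; the sum serves as an upper bound.
  height : C → ℕ
  itemHeight : Item → ℕ
  height (base _) = 0
  height (wit h)  = suc (itemHeight h)
  itemHeight (fut c A)    = height c
  itemHeight (past c A)   = height c
  itemHeight (inst e x ρ) = sum (map (λ y → height (e y)) (freeR ρ))

  ∈⇒≤sum : ∀ {n ns} → n ∈ ns → n ℕ.≤ sum ns
  ∈⇒≤sum (here refl)          = ℕ.m≤m+n _ _
  ∈⇒≤sum {ns = m ∷ _} (there n∈) = ℕ.≤-trans (∈⇒≤sum n∈) (ℕ.m≤n+m _ m)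

  constants-pos-height : ∀ {c} h → c ∈ constants (pos h) → height c ℕ.≤ itemHeight h
  constants-pos-height (fut c A)  (here refl) = ℕ.≤-refl
  constants-pos-height (past c A) (here refl) = ℕ.≤-refl
  constants-pos-height (inst e x ρ) c∈ with ∈-map⁻ e c∈
  ... | y , y∈ , refl = ∈⇒≤sum (∈-map⁺ (λ y → height (e y)) (proj₁ (∈-free-all⁻ ρ y∈)))

  wit∉constants-pos : ∀ h {k} → itemHeight h ℕ.≤ itemHeight k → wit k ∉ constants (pos h)
  wit∉constants-pos h h≤k k∈ = ℕ.<⇒≱ (s≤s h≤k) (constants-pos-height h k∈)

  constants-wits : ∀ {c φ} h → φ ∈ wits h → c ∈ constants φ → c ∈ constants (pos h) ⊎ c ≡ wit h
  constants-wits (fut c A)  (here refl)         (here refl)         = inj₂ refl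
  constants-wits (fut c A)  (there (here refl)) (here refl)         = inj₁ (here refl)
  constants-wits (fut c A)  (there (here refl)) (there (here refl)) = inj₂ refl
  constants-wits (past c A) (here refl)         (here refl)         = inj₂ refl
  constants-wits (past c A) (there (here refl)) (here refl)         = inj₂ refl
  constants-wits (past c A) (there (here refl)) (there (here refl)) = inj₁ (here refl)
  constants-wits {c} h@(inst e x ρ) (here refl) c∈ with ∈-map⁻ (e [ x ↦ wit h ]) c∈
  ... | y , y∈ , c≡ with ∈-++⁻ (freeR ρ) y∈
  ... | inj₁ y∈ρ with em {y ≡ x}
  ... | yes refl = inj₂ c≡
  ... | no  y≢x  = inj₁ (subst (_∈ constants (pos h)) (sym c≡) (∈-map⁺ e (∈-free-all⁺ ρ y∈ρ y≢x)))

  -- Refutability and elimination of witnesses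

  -- Being refutable under every, not only every injective, assignment of
  -- labels makes the notion closed under reassigning a constant.
  Ref : List Closure → Set
  Ref F = ∀ r → map (tr r) F ⊩ rwff ∅

  Ref-weaken : ∀ {F F′} → F ⊆ F′ → Ref F → Ref F′
  Ref-weaken F⊆ d r = weaken (map⁺ (tr r) F⊆) (d r)

  reassign : (C → L) → C → L → C → L
  reassign r w z c = if does (em {c ≡ w}) then z else r c

  reassign-≡ : ∀ r {w z} → reassign r w z w ≡ z
  reassign-≡ r {w} rewrite dec-true (em {w ≡ w}) refl = refl

  reassign-≢ : ∀ r {w z c} → c ≢ w → reassign r w z c ≡ r c
  reassign-≢ r {w} {c = c} c≢w rewrite dec-false (em {c ≡ w}) c≢w = refl

  tr-reassign : ∀ r {w z} K → (∀ {φ} → φ ∈ K → w ∉ constants φ) →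
                map (tr (reassign r w z)) K ≡ map (tr r) K
  tr-reassign r K w∉ = map-cong-local (All.tabulate λ {φ} φ∈ →
    tr-cong φ λ c∈ → reassign-≢ r λ { refl → w∉ φ∈ c∈ })

  fresh-label : ∀ xs Θ → ∃ λ (z : L) → z ∉ xs × (∀ {ψ} → ψ ∈ Θ → z ∉ labels ψ)
  fresh-label xs Θ = let z , z∉ = infinite (xs ++ concat (map labels Θ)) in
    z , z∉ ∘ ∈-++⁺ˡ , λ ψ∈ z∈ → z∉ (∈-++⁺ʳ xs (∈-concat⁺′ z∈ (∈-map⁺ labels ψ∈)))

  -- For a given `r`, the witness is sent to a label `z` fresh for the finite context. This does not
  -- affect the translation of `K`, and it makes `z` an eigenlabel for `GI`, `HI` or `∀I`. So `K`
  -- derives the translation of `pos h`, which is then cut.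
  wit-elim : ∀ h K → (∀ {φ} → φ ∈ K → wit h ∉ constants φ) →
             Ref (pos h ∷ K) → Ref (wits h ++ K) → Ref K
  wit-elim h@(fut c A) K w∉K pos⊩ wits⊩ r
    with fresh-label (r c ∷ []) (map (tr r) K)
  ... | z , z∉ , z∉Θ =
    refute (gi (z∉ ∘ here) z∉Θ (raa⊥ (∅⇒⊥ {x = z} (weaken ctx (wits⊩ s))))) (pos⊩ r)
    where
    s = reassign r (wit h) z
    sc : s c ≡ r c
    sc = reassign-≢ r λ c≡w → wit∉constants-pos h {h} ℕ.≤-refl (here (sym c≡w))
    ctx : map (tr s) (wits h ++ K) ⊆ lwff (z ∶ A ⊃ ⊥′) ∷ rwff (r c < z) ∷ map (tr r) K
    ctx (here p) = here (trans p (cong (λ a → lwff (a ∶ A ⊃ ⊥′)) (reassign-≡ r)))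
    ctx (there (here p)) = there (here (trans p (cong₂ (λ a b → rwff (a < b)) sc (reassign-≡ r))))
    ctx (there (there m)) = there (there (subst (_ ∈_) (tr-reassign r K w∉K) m))
  wit-elim h@(past c A) K w∉K pos⊩ wits⊩ r
    with fresh-label (r c ∷ []) (map (tr r) K)
  ... | z , z∉ , z∉Θ =
    refute (hi (z∉ ∘ here) z∉Θ (raa⊥ (∅⇒⊥ {x = z} (weaken ctx (wits⊩ s))))) (pos⊩ r)
    where
    s = reassign r (wit h) z
    sc : s c ≡ r c
    sc = reassign-≢ r λ c≡w → wit∉constants-pos h {h} ℕ.≤-refl (here (sym c≡w))
    ctx : map (tr s) (wits h ++ K) ⊆ lwff (z ∶ A ⊃ ⊥′) ∷ rwff (z < r c) ∷ map (tr r) K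
    ctx (here p) = here (trans p (cong (λ a → lwff (a ∶ A ⊃ ⊥′)) (reassign-≡ r)))
    ctx (there (here p)) = there (here (trans p (cong₂ (λ a b → rwff (a < b)) (reassign-≡ r) sc)))
    ctx (there (there m)) = there (there (subst (_ ∈_) (tr-reassign r K w∉K) m))
  wit-elim h@(inst e x ρ) K w∉K pos⊩ wits⊩ r
    with fresh-label (map (r ∘ e) (freeR (all x ρ))) (map (tr r) K)
  ... | z , z∉ , z∉Θ =
    refute (all-intro ρ (λ {ψ} ψ∈ → z∉Θ ψ∈ ∘ free⊆labels ψ)
             (λ { y∈ refl → z∉ (∈-map⁺ (r ∘ e) y∈) })
      (raa∅ (weaken ctx (wits⊩ s)))) (pos⊩ r)
    where
    s = reassign r (wit h) z
    agree : ∀ {y} → y ∈ freeR ρ → s ((e [ x ↦ wit h ]) y) ≡ ((r ∘ e) [ x ↦ z ]) y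
    agree {y} y∈ with em {y ≡ x}
    ... | yes _   = reassign-≡ r
    ... | no  y≢x = reassign-≢ r λ ey≡w → wit∉constants-pos h {h} ℕ.≤-refl
      (subst (_∈ constants (pos h)) ey≡w (∈-map⁺ e (∈-free-all⁺ ρ y∈ y≢x)))
    ctx : map (tr s) (wits h ++ K) ⊆ rwff (~ subR ((r ∘ e) [ x ↦ z ]) ρ) ∷ map (tr r) K
    ctx (here p)  = here (trans p (cong (λ ρ′ → rwff (~ ρ′)) (subR-cong ρ agree)))
    ctx (there m) = there (subst (_ ∈_) (tr-reassign r K w∉K) m)

  -- K settles the Henkin axiom for h. This is not a formula in general, as
  -- pos h and wits h may be of different kinds.
  Ok : Item → List Closure → Set
  Ok h K = pos h ∈ K ⊎ wits h ⊆ K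

  Oks : List Item → List Closure → Set
  Oks hs K = ∀ {h} → h ∈ hs → Ok h K

  Ok-mono : ∀ {h K K′} → K ⊆ K′ → Ok h K → Ok h K′
  Ok-mono K⊆ = Sum.map K⊆ (λ w⊆ → K⊆ ∘ w⊆)

  -- Refutability from `F` and the Henkin axioms of `hs`: quantifying over extensions that settle
  -- each item replaces adding the axioms to the context.
  RefWith : List Item → List Closure → Set
  RefWith hs F = ∀ K → F ⊆ K → Oks hs K → Ref K

  lowest : ∀ h hs → ∃ λ m → m ∈ h ∷ hs × (∀ {k} → k ∈ h ∷ hs → itemHeight m ℕ.≤ itemHeight k)
  lowest h hs = m , [ here , there ]′ (argmin-sel itemHeight h hs) ,
    λ { (here refl) → f[argmin]≤f[⊤] {f = itemHeight} h hs
      ; (there k∈) → All.lookup (f[argmin]≤f[xs] {f = itemHeight} h hs) k∈ }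
    where m = argmin itemHeight h hs

  -- An item of least height is removed first: it contains none of the other
  -- constants, so these are still fresh once it has been added to the context.
  wits-elim : ∀ n hs → length hs ℕ.≤ n → ∀ K → (∀ {h φ} → h ∈ hs → φ ∈ K → wit h ∉ constants φ) →
              RefWith hs K → Ref K
  wits-elim n [] _ K _ d = d K id λ ()
  wits-elim (suc n) hs₀@(h ∷ hs) len K fr d = wit-elim m K (fr m∈)
      (wits-elim n hs′ len′ (pos m ∷ K)
        (λ { k∈ (here refl) → wit∉constants-pos m (m≤ (old k∈))
           ; k∈ (there φ∈) → fr (old k∈) φ∈ })
        (λ K′ ⊆K′ oks → d K′ (⊆K′ ∘ there) (oks₀ (inj₁ (⊆K′ (here refl))) oks)))
      (wits-elim n hs′ len′ (wits m ++ K)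
        (λ k∈ φ∈ c∈ → [ (λ φ∈w → [ wit∉constants-pos m (m≤ (old k∈)) , (λ { refl → new k∈ refl }) ]′
                                   (constants-wits m φ∈w c∈))
                      , (λ φ∈K → fr (old k∈) φ∈K c∈) ]′ (∈-++⁻ (wits m) φ∈))
        (λ K′ ⊆K′ oks → d K′ (⊆K′ ∘ ∈-++⁺ʳ (wits m)) (oks₀ (inj₂ (⊆K′ ∘ ∈-++⁺ˡ)) oks)))
    where
    m  = proj₁ (lowest h hs)
    m∈ = proj₁ (proj₂ (lowest h hs))
    m≤ : ∀ {k} → k ∈ h ∷ hs → itemHeight m ℕ.≤ itemHeight k
    m≤ = proj₂ (proj₂ (lowest h hs))
    P? = λ k → ¬? (em {k ≡ m})
    -- All copies of `m` are removed, since `hs` may repeat items and the remaining witnesses must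
    -- differ from that of `m`. The bound `n` makes the recursion structural.
    hs′ = filter P? hs₀
    old : ∀ {k} → k ∈ hs′ → k ∈ hs₀
    old k∈ = proj₁ (∈-filter⁻ P? k∈)
    new : ∀ {k} → k ∈ hs′ → k ≢ m
    new k∈ = proj₂ (∈-filter⁻ P? {xs = hs₀} k∈)
    len′ : length hs′ ℕ.≤ n
    len′ = ℕ.≤-pred (ℕ.≤-trans (filter-notAll P? hs₀ (lose m∈ λ ne → ne refl)) len)
    oks₀ : ∀ {K′} → Ok m K′ → Oks hs′ K′ → Oks hs₀ K′
    oks₀ ok oks {k} k∈ with em {k ≡ m}
    ... | yes refl = ok
    ... | no  k≢m  = oks (∈-filter⁺ P? k∈ k≢m)

  Bad : List Closure → Set
  Bad F = ∃ λ hs → RefWith hs F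

  Bad-mono : ∀ {F F′} → F ⊆ F′ → Bad F → Bad F′
  Bad-mono F⊆ (hs , d) = hs , λ K F′⊆K → d K (F′⊆K ∘ F⊆)

  module ClosureTukey = Tukey em zorn Closure Bad Bad-mono

  -- The canonical model

  module Theory {S : Pred Closure 0ℓ} (maximal-theory : ClosureTukey.Maximal S) where

    open ClosureTukey.Maximal maximal-theory using (good; maximal) renaming (mem to theory) public

    T : Pred Closure 0ℓ
    T φ = theory φ ≡ true

    no-alternative : ∀ φs → ¬ Any T φs →
      ∃ λ F → ∃ λ hs → All T F × (∀ K → F ⊆ K → Oks hs K → All (λ φ → Ref (φ ∷ K)) φs)
    no-alternative [] _ = [] , [] , [] , λ _ _ _ → []
    no-alternative (φ ∷ φs) ∉T with maximal φ (∉T ∘ here) | no-alternative φs (∉T ∘ there)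
    ... | F , F⊆T , hs , d | F′ , hs′ , F′⊆T , ds =
      F ++ F′ , hs ++ hs′ , ++⁺ F⊆T F′⊆T , λ K F⊆K oks →
        d (φ ∷ K) (∷⁺ʳ φ (F⊆K ∘ ∈-++⁺ˡ)) (λ {h} h∈ → Ok-mono {h} there (oks (∈-++⁺ˡ h∈))) ∷
        ds K (F⊆K ∘ ∈-++⁺ʳ F) (oks ∘ ∈-++⁺ʳ hs)

    -- If no alternative is in `T`, maximality supplies a finite part of `T` and finitely many items
    -- against each. Pooled, they satisfy the premises of `rule` and make a finite part of `T` bad.
    -- Consistency, closure, completeness and connectedness are the cases of zero, one, two and
    -- three alternatives.
    prime : ∀ hs F φs → All T F →
            (∀ K → F ⊆ K → Oks hs K → All (λ φ → Ref (φ ∷ K)) φs → Ref K) → Any T φs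
    prime hs F φs F⊆T rule with em {Any T φs}
    ... | yes some = some
    ... | no  none with no-alternative φs none
    ... | F′ , hs′ , F′⊆T , ds = ⊥-elim (good (F ++ F′) (++⁺ F⊆T F′⊆T)
      (hs ++ hs′ , λ K F⊆K oks → rule K (F⊆K ∘ ∈-++⁺ˡ) (oks ∘ ∈-++⁺ˡ)
        (ds K (F⊆K ∘ ∈-++⁺ʳ F) (oks ∘ ∈-++⁺ʳ hs))))

    closed : ∀ F {φ} → All T F → (∀ r → map (tr r) F ⊩ tr r φ) → T φ
    closed F {φ} F⊆T d with prime [] F (φ ∷ []) F⊆T
      (λ { K F⊆K _ (φ⊩ ∷ []) r → refute (weaken (map⁺ (tr r) F⊆K) (d r)) (φ⊩ r) })
    ... | here φ∈T = φ∈T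

    consistent : ∀ F → All T F → ¬ (∀ r → map (tr r) F ⊩ rwff ∅)
    consistent F F⊆T d with prime [] F [] F⊆T (λ K F⊆K _ _ r → weaken (map⁺ (tr r) F⊆K) (d r))
    ... | ()

    complete-lab : ∀ c A → T (c ∶ᶜ A) ⊎ T (c ∶ᶜ A ⊃ ⊥′)
    complete-lab c A with prime [] [] ((c ∶ᶜ A) ∷ (c ∶ᶜ A ⊃ ⊥′) ∷ []) []
      (λ { K _ _ (A⊩ ∷ ¬A⊩ ∷ []) r → refute (raa⊥ (∅⇒⊥ {x = r c} (¬A⊩ r))) (A⊩ r) })
    ... | here A∈           = inj₁ A∈
    ... | there (here ¬A∈) = inj₂ ¬A∈

    complete-rel : ∀ e ρ → T (rel e ρ) ⊎ T (rel e (~ ρ))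
    complete-rel e ρ with prime [] [] (rel e ρ ∷ rel e (~ ρ) ∷ []) []
      (λ { K _ _ (ρ⊩ ∷ ¬ρ⊩ ∷ []) r → cut (raa∅ (¬ρ⊩ r)) (ρ⊩ r) })
    ... | here ρ∈           = inj₁ ρ∈
    ... | there (here ¬ρ∈) = inj₂ ¬ρ∈

    -- Any context that settles `h` already contains one of the two alternatives, so the refutation
    -- of that alternative contracts to one of the context.
    henkin : ∀ h {φ} → φ ∈ wits h → T (pos h) ⊎ T φ
    henkin h {φ} φ∈ with prime (h ∷ []) [] (pos h ∷ φ ∷ []) []
      (λ { K _ oks (pos⊩ ∷ φ⊩ ∷ []) →
           [ (λ pos∈ → Ref-weaken (∈-∷⁺ʳ pos∈ ⊆-refl) pos⊩)
           , (λ w⊆ → Ref-weaken (∈-∷⁺ʳ (w⊆ φ∈) ⊆-refl) φ⊩) ]′ (oks (here refl)) })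
    ... | here pos∈        = inj₁ pos∈
    ... | there (here φ∈T) = inj₂ φ∈T

    -- A maximal set of constants free of clashes is a transversal of provable equality. Choosing
    -- representatives avoids quotients, while `≐` must be interpreted as genuine equality of
    -- worlds.
    Clash : List C → Set
    Clash F = ∃ λ c → ∃ λ d → c ∈ F × d ∈ F × T (c ≐ᶜ d) × c ≢ d

    Clash-mono : ∀ {F F′} → F ⊆ F′ → Clash F → Clash F′
    Clash-mono F⊆ (c , d , c∈ , d∈ , c≐d , c≢d) = c , d , F⊆ c∈ , F⊆ d∈ , c≐d , c≢d

    module Transversal = Tukey em zorn C Clash Clash-mono

    transversal : Transversal.Maximal (λ _ → ⊥)
    transversal = Transversal.tukey (λ _ → ⊥) λ { [] _ (_ , _ , () , _) ; (_ ∷ _) (() ∷ _) }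

    module Canonical (maximal-transversal : Transversal.Maximal (λ _ → ⊥)) where

      open Transversal.Maximal maximal-transversal
        using () renaming (mem to chosen; good to chosen-good; maximal to chosen-maximal)

      World : Set
      World = Σ C λ c → chosen c ≡ true

      World-≡ : ∀ {u v : World} → proj₁ u ≡ proj₁ v → u ≡ v
      World-≡ {c , p} {.c , q} refl = cong (c ,_) (uip p q)

      represented : ∀ c → ∃ λ (w : World) → T (proj₁ w ≐ᶜ c)
      represented c with em {chosen c ≡ true}
      ... | yes p = (c , p) , closed [] [] (λ r → eq-refl (r c))
      -- Adding `c` creates a clash, which must involve `c` because the chosen constants have none;
      -- its other member represents `c`.
      ... | no ¬p with chosen-maximal c ¬p
      ... | F , F⊆ , a , b , here refl , here refl , a≐b , a≢b = ⊥-elim (a≢b refl)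
      ... | F , F⊆ , a , b , here refl , there b∈ , a≐b , a≢b =
        (b , All.lookup F⊆ b∈) , closed ((a ≐ᶜ b) ∷ []) (a≐b ∷ []) (λ r → eq-sym hyp₀)
      ... | F , F⊆ , a , b , there a∈ , here refl , a≐b , a≢b = (a , All.lookup F⊆ a∈) , a≐b
      ... | F , F⊆ , a , b , there a∈ , there b∈ , a≐b , a≢b =
        ⊥-elim (chosen-good F F⊆ (a , b , a∈ , b∈ , a≐b , a≢b))

      rep : C → World
      rep c = proj₁ (represented c)

      rep-≐ : ∀ c → T (proj₁ (rep c) ≐ᶜ c)
      rep-≐ c = proj₂ (represented c)

      ≐⇒≡ : ∀ {u v : World} → T (proj₁ u ≐ᶜ proj₁ v) → u ≡ v
      ≐⇒≡ {u , p} {v , q} u≐v with em {u ≡ v}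
      ... | yes u≡v = World-≡ u≡v
      ... | no  u≢v = ⊥-elim (chosen-good (u ∷ v ∷ []) (p ∷ q ∷ [])
        (u , v , here refl , there (here refl) , u≐v , u≢v))

      rep-world : ∀ w → rep (proj₁ w) ≡ w
      rep-world w = ≐⇒≡ (rep-≐ (proj₁ w))

      canonical : Model
      canonical = record
        { W = World
        ; nonempty = rep (base (proj₁ (infinite [])))
        ; _≺_ = λ u v → T (proj₁ u <ᶜ proj₁ v)
        ; irrefl = λ { refl u<u → consistent _ (u<u ∷ []) λ r → lt-irrefl hyp₀ }
        ; trans = λ u<v v<w → closed _ (u<v ∷ v<w ∷ []) λ r → lt-trans hyp₀ hyp₁
        ; connected = connected
        ; V = λ w p → theory (proj₁ w ∶ᶜ var p)
        }
        where
        connected : ∀ (u v : World) → u ≡ v ⊎ T (proj₁ u <ᶜ proj₁ v) ⊎ T (proj₁ v <ᶜ proj₁ u)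
        connected u v with prime [] []
          ((proj₁ u ≐ᶜ proj₁ v) ∷ (proj₁ u <ᶜ proj₁ v) ∷ (proj₁ v <ᶜ proj₁ u) ∷ []) []
          (λ { K _ _ (eq ∷ lt ∷ gt ∷ []) r → lt-connected _ _ (eq r) (lt r) (gt r) })
        ... | here eq                 = inj₁ (≐⇒≡ eq)
        ... | there (here lt)         = inj₂ (inj₁ lt)
        ... | there (there (here gt)) = inj₂ (inj₂ gt)

      -- Truth lemmas for labeled and relational formulas

      lab⇔ : ∀ c A → T (proj₁ (rep c) ∶ᶜ A) ⇔ T (c ∶ᶜ A)
      lab⇔ c A = mk⇔
        (λ t → closed _ (t ∷ rep-≐ c ∷ []) λ r → lab-resp hyp₀ hyp₁)
        (λ t → closed _ (t ∷ rep-≐ c ∷ []) λ r → lab-resp hyp₀ (eq-sym hyp₁))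

      contradictory : ∀ {c A} → T (c ∶ᶜ A) → ¬ T (c ∶ᶜ A ⊃ ⊥′)
      contradictory t ¬t = consistent _ (t ∷ ¬t ∷ []) λ r → ⊥⇒∅ (⊃e hyp₁ hyp₀)

      Sat⇔T : ∀ A (w : World) → Sat canonical w A ⇔ T (proj₁ w ∶ᶜ A)
      Sat⇔T (var p) w = mk⇔ id id
      Sat⇔T ⊥′ w = mk⇔ ⊥-elim (λ t → consistent _ (t ∷ []) λ r → ⊥⇒∅ hyp₀)
      Sat⇔T (A ⊃ B) w = mk⇔ fwd bwd
        where
        fwd : (Sat canonical w A → Sat canonical w B) → T (proj₁ w ∶ᶜ A ⊃ B)
        fwd s with complete-lab (proj₁ w) A
        ... | inj₁ t  = closed _ (to (Sat⇔T B w) (s (from (Sat⇔T A w) t)) ∷ [])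
                          λ r → ⊃i hyp₁
        ... | inj₂ ¬t = closed _ (¬t ∷ []) λ r →
                          ⊃i (raa⊥ (⊃e hyp₂ hyp₁))
        bwd : T (proj₁ w ∶ᶜ A ⊃ B) → Sat canonical w A → Sat canonical w B
        bwd t s = from (Sat⇔T B w)
          (closed _ (t ∷ to (Sat⇔T A w) s ∷ []) λ r → ⊃e hyp₀ hyp₁)
      Sat⇔T (G A) w = mk⇔ fwd
        (λ t v w<v → from (Sat⇔T A v) (closed _ (t ∷ w<v ∷ []) λ r → ge hyp₀ hyp₁))
        where
        h = fut (proj₁ w) A
        -- The witness itself need not be a world, so its representative is used and the
        -- contradiction is carried back along `lab⇔`.
        v = rep (wit h)
        fwd : (∀ v → T (proj₁ w <ᶜ proj₁ v) → Sat canonical v A) → T (proj₁ w ∶ᶜ G A)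
        -- The two witness formulas are obtained separately; unless `pos h` appears, both are in
        -- `T`.
        fwd s with henkin h (here refl) | henkin h (there (here refl))
        ... | inj₁ t  | _       = t
        ... | inj₂ _  | inj₁ t  = t
        ... | inj₂ ¬A | inj₂ lt = ⊥-elim (contradictory (to (lab⇔ (wit h) A)
          (to (Sat⇔T A v)
            (s v (closed _ (lt ∷ rep-≐ (wit h) ∷ []) λ r → lt-respʳ hyp₀ (eq-sym hyp₁))))) ¬A)
      Sat⇔T (H A) w = mk⇔ fwd
        (λ t v v<w → from (Sat⇔T A v) (closed _ (t ∷ v<w ∷ []) λ r → he hyp₀ hyp₁))
        where
        h = past (proj₁ w) A
        v = rep (wit h)
        fwd : (∀ v → T (proj₁ v <ᶜ proj₁ w) → Sat canonical v A) → T (proj₁ w ∶ᶜ H A)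
        fwd s with henkin h (here refl) | henkin h (there (here refl))
        ... | inj₁ t  | _       = t
        ... | inj₂ _  | inj₁ t  = t
        ... | inj₂ ¬A | inj₂ lt = ⊥-elim (contradictory (to (lab⇔ (wit h) A)
          (to (Sat⇔T A v)
            (s v (closed _ (lt ∷ rep-≐ (wit h) ∷ []) λ r → lt-respˡ hyp₀ (eq-sym hyp₁))))) ¬A)

      TrueR⇔T : ∀ ρ e → TrueR canonical (rep ∘ e) ρ ⇔ T (rel e ρ)
      TrueR⇔T (x < y) e = mk⇔
        (λ t → closed _ (t ∷ rep-≐ (e x) ∷ rep-≐ (e y) ∷ []) λ r →
          lt-respʳ (lt-respˡ hyp₀ hyp₁) hyp₂)
        (λ t → closed (rel e (x < y) ∷ _) (t ∷ rep-≐ (e x) ∷ rep-≐ (e y) ∷ []) λ r →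
          lt-respʳ (lt-respˡ hyp₀ (eq-sym hyp₁)) (eq-sym hyp₂))
      TrueR⇔T (x ≐ y) e = mk⇔
        (λ eq → closed _ (rep-≐ (e x) ∷ subst (λ w → T (proj₁ w ≐ᶜ e y)) (sym eq) (rep-≐ (e y)) ∷ [])
          λ r → eq-trans (eq-sym hyp₀) hyp₁)
        (λ t → ≐⇒≡ (closed (rel e (x ≐ y) ∷ _) (t ∷ rep-≐ (e x) ∷ rep-≐ (e y) ∷ []) λ r →
          eq-trans hyp₁ (eq-trans hyp₀ (eq-sym hyp₂))))
      TrueR⇔T ∅ e = mk⇔ ⊥-elim (λ t → consistent (rel e ∅ ∷ []) (t ∷ []) λ r → hyp₀)
      TrueR⇔T (ρ ⊐ ρ′) e = mk⇔ fwd bwd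
        where
        fwd : (TrueR canonical (rep ∘ e) ρ → TrueR canonical (rep ∘ e) ρ′) → T (rel e (ρ ⊐ ρ′))
        fwd s with complete-rel e ρ
        ... | inj₁ t  = closed (rel e ρ′ ∷ [])
          (to (TrueR⇔T ρ′ e) (s (from (TrueR⇔T ρ e) t)) ∷ []) λ r → ⊐i hyp₁
        ... | inj₂ ¬t = closed (rel e (~ ρ) ∷ []) (¬t ∷ []) λ r → ⊐i (ex-falso (⊐e hyp₁ hyp₀))
        bwd : T (rel e (ρ ⊐ ρ′)) → TrueR canonical (rep ∘ e) ρ → TrueR canonical (rep ∘ e) ρ′
        bwd t s = from (TrueR⇔T ρ′ e)
          (closed (rel e (ρ ⊐ ρ′) ∷ rel e ρ ∷ []) (t ∷ to (TrueR⇔T ρ e) s ∷ [])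
            λ r → ⊐e hyp₀ hyp₁)
      TrueR⇔T (all x ρ) e = mk⇔ fwd bwd
        where
        h = inst e x ρ
        e′ = e [ x ↦ wit h ]
        fwd : (∀ w → TrueR canonical ((rep ∘ e) [ x ↦ w ]) ρ) → T (rel e (all x ρ))
        fwd s with henkin h (here refl)
        ... | inj₁ t  = t
        ... | inj₂ ¬t = ⊥-elim (consistent (rel e′ ρ ∷ rel e′ (~ ρ) ∷ [])
            (to (TrueR⇔T ρ e′) (TrueR-cong canonical ρ (λ _ → sym (upd-∘ rep e)) (s (rep (wit h))))
              ∷ ¬t ∷ [])
            λ r → ⊐e hyp₁ hyp₀)
        bwd : T (rel e (all x ρ)) → ∀ w → TrueR canonical ((rep ∘ e) [ x ↦ w ]) ρ
        bwd t w = TrueR-cong canonical ρ agree (from (TrueR⇔T ρ (e [ x ↦ proj₁ w ]))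
          (closed (rel e (all x ρ) ∷ []) (t ∷ []) λ r →
            subst (λ ρ′ → _ ⊩ rwff ρ′) (subR-cong ρ (λ _ → sym (upd-∘ r e)))
              (all-elim ρ (r (proj₁ w)) hyp₀)))
          where
          agree : ∀ {y} → y ∈ freeR ρ → rep ((e [ x ↦ proj₁ w ]) y) ≡ ((rep ∘ e) [ x ↦ w ]) y
          agree _ = trans (upd-∘ rep e)
            (upd-cong (rep ∘ e) (rep ∘ e) (λ _ → rep-world w) (λ _ → refl))

  -- Return to the original language and completeness

  embed : Formula → Closure
  embed (lwff (x ∶ A)) = base x ∶ᶜ A
  embed (rwff ρ)       = rel base ρ

  wit∉constants-embed : ∀ h φ → wit h ∉ constants (embed φ)
  wit∉constants-embed h (lwff (_ ∶ _)) (here ())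
  wit∉constants-embed h (rwff ρ)       w∈ with ∈-map⁻ base w∈
  ... | _ , _ , ()

  -- The value at witnesses is arbitrary, as embedded formulas contain none.
  unbase : C → L
  unbase (base x) = x
  unbase (wit _)  = proj₁ (infinite [])

  tr-embed : ∀ φ → tr unbase (embed φ) ≡ φ
  tr-embed (lwff (x ∶ A)) = refl
  tr-embed (rwff ρ)       = cong rwff (subR-id ρ λ _ → refl)

  neg : Formula → Formula
  neg (lwff (x ∶ A)) = lwff (x ∶ A ⊃ ⊥′)
  neg (rwff ρ)       = rwff (~ ρ)

  neg-True : ∀ {M f} φ → True M f (neg φ) → ¬ True M f φ
  neg-True (lwff (x ∶ A)) = id
  neg-True (rwff ρ)       = id

  module _ (Γ : Pred LWff 0ℓ) (Δ : Pred RWff 0ℓ) where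

    -- `neg φ` is exactly what the `RAA` rule of the matching kind discharges, so only assumptions
    -- from `Γ` and `Δ` stay open.
    by-refutation : ∀ {Θ} φ → (∀ {ψ} → ψ ∈ Θ → ψ ∈⟨ Γ ⨾ Δ ⟩ ⊎ ψ ≡ neg φ) →
                    Θ ⊩ rwff ∅ → Γ ⨾ Δ ⊢ φ
    by-refutation (lwff (x ∶ A)) Θ⊆ (d , o) = RAA⊥ {x} {x} (uf2 d) ,
      λ ψ (p , ψ≢) → [ id , (λ eq → contradiction eq ψ≢) ]′ (Θ⊆ (o ψ p))
    by-refutation (rwff ρ) Θ⊆ (d , o) = RAA∅ d ,
      λ ψ (p , ψ≢) → [ id , (λ eq → contradiction eq ψ≢) ]′ (Θ⊆ (o ψ p))

    complete : ∀ φ → (∀ (M : Model) (f : Interpretation M) → Γ ⨾ Δ ⊨[ M , f ] φ) → Γ ⨾ Δ ⊢ φ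
    complete φ valid with em {Γ ⨾ Δ ⊢ φ}
    ... | yes d = d
    ... | no ¬d = ⊥-elim (neg-True φ (holds (inj₂ refl))
        (valid canonical (rep ∘ base) λ ψ → holds {ψ} ∘ inj₁))
      where
      S : Pred Closure 0ℓ
      S c = ∃ λ ψ → (ψ ∈⟨ Γ ⨾ Δ ⟩ ⊎ ψ ≡ neg φ) × c ≡ embed ψ

      S-good : ClosureTukey.Good S
      -- Embedded formulas are free of witnesses, so `wits-elim` removes every Henkin condition;
      -- translating by `unbase` then gives a refutation in the original labels.
      S-good F F⊆S (hs , d) = ¬d (by-refutation φ back
          (wits-elim (length hs) hs ℕ.≤-refl F fr d unbase))
        where
        fr : ∀ {h χ} → h ∈ hs → χ ∈ F → wit h ∉ constants χ
        fr {h} _ χ∈ with All.lookup F⊆S χ∈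
        ... | ψ , _ , refl = wit∉constants-embed h ψ
        back : ∀ {ψ} → ψ ∈ map (tr unbase) F → ψ ∈⟨ Γ ⨾ Δ ⟩ ⊎ ψ ≡ neg φ
        back ψ∈ with ∈-map⁻ (tr unbase) ψ∈
        ... | χ , χ∈ , refl with All.lookup F⊆S χ∈
        ... | ψ , p , refl = subst (λ ψ → ψ ∈⟨ Γ ⨾ Δ ⟩ ⊎ ψ ≡ neg φ) (sym (tr-embed ψ)) p

      maximal-theory : ClosureTukey.Maximal S
      maximal-theory = ClosureTukey.tukey S S-good

      open Theory maximal-theory
      open Canonical transversal

      embed-True : ∀ ψ → T (embed ψ) → True canonical (rep ∘ base) ψ
      embed-True (lwff (x ∶ A)) t = from (TrueL⇔Sat canonical A)
        (from (Sat⇔T A (rep (base x))) (from (lab⇔ (base x) A) t))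
      embed-True (rwff ρ) t = from (TrueR⇔T ρ base) t

      holds : ∀ {ψ} → ψ ∈⟨ Γ ⨾ Δ ⟩ ⊎ ψ ≡ neg φ → True canonical (rep ∘ base) ψ
      holds {ψ} p = embed-True ψ (ClosureTukey.Maximal.includes maximal-theory (ψ , p , refl))

theorem6 : (em : ExcludedMiddle 0ℓ) → ZornsLemma 0ℓ →
    (L Var : Set) (infinite : Infinite L) →
    let open LinearTense L Var (λ _ _ → em) infinite in
    (Γ : Pred LWff 0ℓ) (Δ : Pred RWff 0ℓ) (φ : Formula) →
    (Γ ⨾ Δ ⊢ φ) ⇔ (∀ (M : Model) (λ′ : Interpretation M) → Γ ⨾ Δ ⊨[ M , λ′ ] φ)
theorem6 em zorn L Var infinite Γ Δ φ = mk⇔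
  (λ (d , o) M f as → Calculus.sound em zorn L Var infinite M d f λ ψ → as ψ ∘ o ψ)
  (Calculus.complete em zorn L Var infinite Γ Δ φ)
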